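{- Let $N\ge 1$ and $\nu\in\mathbb S_N$. For $k\in\mathbb Z$ put $F_k(\nu):=\mathrm{Dim}_{1,N}(k,\nu)/\mathrm{Dim}_N\nu$, and set $$H^*(t;\nu)=\prod_{j=1}^N\frac{t+j}{t+j-\nu_j},$$ where $t$ is a formal variable. Then the following identity of rational functions of $t$ holds: $$H^*(t;\nu)=\sum_{k\in\mathbb Z}F_k(\nu)\,\frac{(t+1)(t+2)\cdots(t+N)}{(t+1-k)(t+2-k)\cdots(t+N-k)}.$$ The sum is finite, because $F_k(\nu)=0$ unless $\nu_N\le k\le\nu_1$.
   Context: For $N\ge1$, a signature of length $N$ is an $N$-tuple of integers $\nu=(\nu_1\ge\nu_2\ge\dots\ge\nu_N)$, and $\mathbb S_N\subset\mathbb Z^N$ denotes the set of all of them; in particular $\mathbb S_1=\mathbb Z$. For $\nu\in\mathbb S_N$ and $\lambda\in\mathbb S_{N-1}$ write $\lambda\prec\nu$ (the two signatures are interlaced) if $\nu_i\ge\lambda_i\ge\nu_{i+1}$ for $i=1,\dots,N-1$. Weyl's dimension is $\mathrm{Dim}_N\nu=\prod_{1\le i<j\le N}\frac{\nu_i-\nu_j-i+j}{j-i}$. For $K<N$, $\kappa\in\mathbb S_K$ and $\nu\in\mathbb S_N$, $\mathrm{Dim}_{K,N}(\kappa,\nu)$ is the number of chains $\kappa=\lambda^{(K)}\prec\lambda^{(K+1)}\prec\dots\prec\lambda^{(N)}=\nu$ with $\lambda^{(j)}\in\mathbb S_j$. -}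

module Defs where

open import Algebra.Bundles using (AbelianGroup)
open import Algebra.Properties.Group using (∙-cancelˡ)
open import Data.Empty using (⊥-elim)
open import Data.Fin.Base as Fin using (Fin; zero; suc; toℕ; Fin′; inject; inject₁; fromℕ)
import Data.Fin.Properties as Fin
open import Data.Integer.Base as ℤ using (ℤ; +_; _≤_; _≥_)
import Data.Integer.Properties as ℤ
open import Data.Integer.Tactic.RingSolver using (solve-∀)
open import Data.List.Base as List
  using (List; []; _∷_; [_]; _++_; length; concatMap; applyUpTo; cartesianProductWith)
open import Data.List.Membership.Propositional using (_∈_; _∉_; mapWith∈; find; lose)
open import Data.List.Membership.Propositional.Properties
open import Data.List.Relation.Unary.All as All using ([]; _∷_)
import Data.List.Relation.Unary.All.Properties as All
open import Data.List.Relation.Unary.AllPairs as AllPairs using ([]; _∷_)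
import Data.List.Relation.Unary.AllPairs.Properties as AllPairs
open import Data.List.Relation.Unary.Any using (here; there)
open import Data.List.Relation.Unary.Unique.Propositional using (Unique)
import Data.List.Relation.Unary.Unique.Propositional.Properties as Unique
open import Data.Nat.Base as ℕ using (ℕ; zero; suc)
import Data.Nat.Properties as ℕ
open import Data.Product.Base using (Σ; _×_; _,_; proj₁; proj₂; -,_)
open import Data.Product.Properties using (≡-dec)
open import Data.Rational.Base as ℚ using (ℚ; 0ℚ; 1ℚ; _/_; _÷_)
import Data.Rational.Properties as ℚ
open import Data.Vec.Base as Vec using (Vec; []; _∷_; lookup)
open import Data.Vec.Functional using (Vector; foldr)
import Data.Vec.Properties as Vec
open import Data.Vec.Relation.Unary.Linked as Linked using (Linked; []; [-]; _∷_)
import Data.Vec.Relation.Unary.Linked.Properties as Linked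
open import Function.Base using (_∘_; id)
open import Relation.Binary.Definitions using (DecidableEquality)
open import Relation.Binary.PropositionalEquality
  using (_≡_; _≢_; refl; sym; trans; cong; subst; subst₂; module ≡-Reasoning)
open import Relation.Nullary using (¬_; Dec; yes; no; recompute)
open import Relation.Nullary.Decidable using (map′; _×-dec_)

record Sig (N : ℕ) : Set where
  constructor sig
  field
    entries    : Vec ℤ N
    decreasing : Linked _≥_ entries

open Sig public

infix 8 _!_

-- Indices start at zero: ν ! i is the entry ν_{i+1} of the usual notation.
_!_ : ∀ {N} → Sig N → Fin N → ℤ
ν ! i = lookup (entries ν) i

singleton : ℤ → Sig 1
singleton k = sig (k ∷ []) [-]

infix 4 _≺_ _≺?_

_≺_ : ∀ {N} → Sig N → Sig (suc N) → Set
μ ≺ ν = ∀ i → ν ! inject₁ i ≥ μ ! i × μ ! i ≥ ν ! suc i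

_≺?_ : ∀ {N} (μ : Sig N) (ν : Sig (suc N)) → Dec (μ ≺ ν)
μ ≺? ν = Fin.all? λ i → (μ ! i ℤ.≤? ν ! inject₁ i) ×-dec (ν ! suc i ℤ.≤? μ ! i)

entries-injective : ∀ {N} {μ ν : Sig N} → entries μ ≡ entries ν → μ ≡ ν
entries-injective {μ = sig v p} {ν = sig .v q} refl =
  cong (sig v) (Linked.irrelevant ℤ.≤-irrelevant p q)

_≟ˢ_ : ∀ {N} → DecidableEquality (Sig N)
μ ≟ˢ ν = map′ entries-injective (cong entries)
              (Vec.≡-dec ℤ._≟_ (entries μ) (entries ν))

infixl 5 _▷_

-- Chains κ = λ⁽ᴷ⁾ ≺ λ⁽ᴷ⁺¹⁾ ≺ … ≺ λ⁽ᴺ⁾ = ν.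
-- The interlacing proofs are irrelevant, so two chains are equal exactly
-- when they consist of the same signatures.
data Chain {K} (κ : Sig K) : ∀ {N} → Sig N → Set where
  stop : Chain κ κ
  _▷_  : ∀ {N} {μ : Sig N} {ν : Sig (suc N)} → Chain κ μ → .(μ ≺ ν) → Chain κ ν

record Below {N} (ν : Sig (suc N)) : Set where
  constructor _because_
  field
    lower       : Sig N
    .interlaces : lower ≺ ν

open Below public using (lower)

lower-injective : ∀ {N} {ν : Sig (suc N)} {b c : Below ν} →
                  lower b ≡ lower c → b ≡ c
lower-injective refl = refl

-- For a ≤ b these are the integers a, a+1, …, b.
interval : ℤ → ℤ → List ℤ
interval a b = applyUpTo (λ i → a ℤ.+ + i) (suc ℤ.∣ b ℤ.- a ∣)

a+∣k-a∣≡k : ∀ {a k} → a ≤ k → a ℤ.+ + ℤ.∣ k ℤ.- a ∣ ≡ k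
a+∣k-a∣≡k {a} {k} a≤k =
  trans (cong (λ z → a ℤ.+ z) (ℤ.0≤i⇒+∣i∣≡i (ℤ.i≤j⇒0≤j-i a≤k))) (lemma a k)
  where
  lemma : ∀ a k → a ℤ.+ (k ℤ.- a) ≡ k
  lemma = solve-∀

interval⁺ : ∀ {a b k} → a ≤ k → k ≤ b → k ∈ interval a b
interval⁺ {a} {b} {k} a≤k k≤b =
  subst (_∈ interval a b) (a+∣k-a∣≡k a≤k)
    (∈-applyUpTo⁺ (λ i → a ℤ.+ + i) (ℕ.s≤s (ℤ.drop‿+≤+ ∣k-a∣≤∣b-a∣)))
  where
  ∣k-a∣≤∣b-a∣ : + ℤ.∣ k ℤ.- a ∣ ≤ + ℤ.∣ b ℤ.- a ∣
  ∣k-a∣≤∣b-a∣ = subst₂ _≤_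
    (sym (ℤ.0≤i⇒+∣i∣≡i (ℤ.i≤j⇒0≤j-i a≤k)))
    (sym (ℤ.0≤i⇒+∣i∣≡i (ℤ.i≤j⇒0≤j-i (ℤ.≤-trans a≤k k≤b))))
    (ℤ.+-monoˡ-≤ (ℤ.- a) k≤b)

interval⁻ : ∀ {a b k} → a ≤ b → k ∈ interval a b → a ≤ k × k ≤ b
interval⁻ {a} {b} a≤b k∈ with ∈-applyUpTo⁻ (λ i → a ℤ.+ + i) k∈
... | i , ℕ.s≤s i≤ , refl =
  ℤ.i≤i+j a (+ i) ,
  subst (a ℤ.+ + i ≤_) (a+∣k-a∣≡k a≤b) (ℤ.+-monoʳ-≤ a (ℤ.+≤+ i≤))

interval-unique : ∀ a b → Unique (interval a b)
interval-unique a b = Unique.applyUpTo⁺₁ _ _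
  λ i<j _ eq → ℕ.<⇒≢ i<j (ℤ.+-injective (∙-cancelˡ (AbelianGroup.group ℤ.+-0-abelianGroup) a _ _ eq))

-- All integer vectors v with v_i between ν_{i+1} and ν_i.
interlacing : ∀ {N} → Vec ℤ (suc N) → List (Vec ℤ N)
interlacing (x ∷ [])    = [ [] ]
interlacing (x ∷ y ∷ v) =
  cartesianProductWith _∷_ (interval y x) (interlacing (y ∷ v))

Between : ∀ {N} → Vec ℤ N → Vec ℤ (suc N) → Set
Between u v = ∀ i → lookup v (inject₁ i) ≥ lookup u i × lookup u i ≥ lookup v (suc i)

interlacing⁻ : ∀ {N} {v : Vec ℤ (suc N)} → Linked _≥_ v →
               ∀ {u} → u ∈ interlacing v → Linked _≥_ u × Between u v
interlacing⁻ {v = x ∷ []} _ (here refl) = [] , λ ()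
interlacing⁻ {v = x ∷ y ∷ v} (x≥y ∷ dec) u∈
  with ∈-cartesianProductWith⁻ _∷_ (interval y x) (interlacing (y ∷ v)) u∈
... | k , u , k∈ , u∈′ , refl
  with interval⁻ x≥y k∈ | interlacing⁻ dec u∈′
... | y≤k , k≤x | dec′ , btw = cons u dec′ btw , λ where
      zero    → k≤x , y≤k
      (suc i) → btw i
  where
  cons : ∀ u → Linked _≥_ u → Between u (y ∷ v) → Linked _≥_ (k ∷ u)
  cons []      _ _   = [-]
  cons (_ ∷ _) p btw = ℤ.≤-trans (proj₁ (btw zero)) y≤k ∷ p

interlacing⁺ : ∀ {N} (u : Vec ℤ N) (v : Vec ℤ (suc N)) →
               Between u v → u ∈ interlacing v
interlacing⁺ []      (x ∷ [])    _   = here refl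
interlacing⁺ (k ∷ u) (x ∷ y ∷ v) btw =
  ∈-cartesianProductWith⁺ _∷_ (interval⁺ (proj₂ (btw zero)) (proj₁ (btw zero)))
                              (interlacing⁺ u (y ∷ v) (btw ∘ suc))

interlacing-unique : ∀ {N} (v : Vec ℤ (suc N)) → Unique (interlacing v)
interlacing-unique (x ∷ [])    = [] ∷ []
interlacing-unique (x ∷ y ∷ v) =
  Unique.cartesianProductWith⁺ _∷_ Vec.∷-injective
    (interval-unique y x) (interlacing-unique (y ∷ v))

below : ∀ {N} (ν : Sig (suc N)) → List (Below ν)
below ν = mapWith∈ (interlacing (entries ν)) λ {u} u∈ →
  sig u (proj₁ (interlacing⁻ (decreasing ν) u∈)) because
    proj₂ (interlacing⁻ (decreasing ν) u∈)

map-below : ∀ {N} (ν : Sig (suc N)) →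
            List.map (entries ∘ lower) (below ν) ≡ interlacing (entries ν)
map-below ν = trans (map-mapWith∈ (interlacing (entries ν)) _ (entries ∘ lower))
                    (mapWith∈-id _)

below-unique : ∀ {N} (ν : Sig (suc N)) → Unique (below ν)
below-unique ν = Unique.map⁻
  (subst Unique (sym (map-below ν)) (interlacing-unique (entries ν)))

below-complete : ∀ {N} (ν : Sig (suc N)) (b : Below ν) → b ∈ below ν
below-complete ν b@(μ because μ≺ν)
  with ∈-map⁻ (entries ∘ lower)
         (subst (entries μ ∈_) (sym (map-below ν))
           (interlacing⁺ (entries μ) (entries ν) (recompute (μ ≺? ν) μ≺ν)))
... | c , c∈ , eq =
  subst (_∈ below ν) (sym (lower-injective {b = b} (entries-injective eq))) c∈

extend : ∀ {K N} {κ : Sig K} {ν : Sig (suc N)} (b : Below ν) →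
         Chain κ (lower b) → Chain κ ν
extend (_ because μ≺ν) c = c ▷ μ≺ν

module _ {K} (κ : Sig K) where

  stops : ∀ {N} {ν : Sig N} → Dec ((K , κ) ≡ (N , ν)) → List (Chain κ ν)
  stops (yes refl) = [ stop ]
  stops (no _)     = []

  _≟κ : ∀ {N} (ν : Sig N) → Dec ((K , κ) ≡ (N , ν))
  ν ≟κ = ≡-dec ℕ._≟_ _≟ˢ_ (K , κ) (-, ν)

  chains : ∀ {N} (ν : Sig N) → List (Chain κ ν)
  chains {zero}  ν = stops (ν ≟κ)
  chains {suc N} ν = stops (ν ≟κ) ++
    concatMap (λ b → List.map (extend b) (chains (lower b))) (below ν)

  stops-unique : ∀ {N} {ν : Sig N} (d : Dec ((K , κ) ≡ (N , ν))) → Unique (stops d)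
  stops-unique (yes refl) = [] ∷ []
  stops-unique (no _)     = []

  ∈-stops : (d : Dec ((K , κ) ≡ (K , κ))) → stop ∈ stops d
  ∈-stops (yes refl) = here refl
  ∈-stops (no ≢)     = ⊥-elim (≢ refl)

  ∈-stops-chains : ∀ {N} (ν : Sig N) {c} → c ∈ stops (ν ≟κ) → c ∈ chains ν
  ∈-stops-chains {zero}  ν c∈ = c∈
  ∈-stops-chains {suc N} ν c∈ = ∈-++⁺ˡ c∈

  ▷-injective : ∀ {N} {μ : Sig N} {ν : Sig (suc N)} .{p : μ ≺ ν} {c d : Chain κ μ} →
                _≡_ {A = Chain κ ν} (c ▷ p) (d ▷ p) → c ≡ d
  ▷-injective refl = refl

  ▷-lower : ∀ {N} {μ μ′ : Sig N} {ν : Sig (suc N)} .{p : μ ≺ ν} .{q : μ′ ≺ ν}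
            {c : Chain κ μ} {d : Chain κ μ′} →
            _≡_ {A = Chain κ ν} (c ▷ p) (d ▷ q) → μ ≡ μ′
  ▷-lower refl = refl

  stop≢▷ : ∀ {N} {μ : Sig N} {ν : Sig (suc N)} .{p : μ ≺ ν} {c : Chain κ μ}
           (d : Dec ((K , κ) ≡ (suc N , ν))) → (c ▷ p) ∉ stops d
  stop≢▷ (yes refl) (here ())
  stop≢▷ (yes refl) (there ())
  stop≢▷ (no _)     ()

  chains-unique : ∀ {N} (ν : Sig N) → Unique (chains ν)
  chains-unique {zero}  ν = stops-unique (ν ≟κ)
  chains-unique {suc N} ν = Unique.++⁺ (stops-unique (ν ≟κ))
    (Unique.concat⁺
      (All.map⁺ (All.universal (λ b → Unique.map⁺ ▷-injective (chains-unique (lower b))) (below ν)))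
      (AllPairs.map⁺ (AllPairs.map disjoint (below-unique ν))))
    λ { (c∈stops , c∈steps) → separate c∈stops c∈steps }
    where
    disjoint : ∀ {b b′} → b ≢ b′ → ∀ {c} →
               ¬ (c ∈ List.map (extend b) (chains (lower b)) ×
                  c ∈ List.map (extend b′) (chains (lower b′)))
    disjoint {b} {b′} b≢b′ (c∈ , c∈′) with ∈-map⁻ (extend b) c∈ | ∈-map⁻ (extend b′) c∈′
    ... | _ , _ , refl | _ , _ , eq = b≢b′ (lower-injective (▷-lower eq))

    separate : ∀ {c} → c ∈ stops (ν ≟κ) →
               c ∉ concatMap (λ b → List.map (extend b) (chains (lower b))) (below ν)
    separate c∈stops c∈steps
      with find (∈-concatMap⁻ (λ b → List.map (extend b) (chains (lower b))) {xs = below ν} c∈steps)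
    ... | b , _ , c∈ with ∈-map⁻ (extend b) c∈
    ... | _ , _ , refl = stop≢▷ (ν ≟κ) c∈stops

  chains-complete : ∀ {N} {ν : Sig N} (c : Chain κ ν) → c ∈ chains ν
  chains-complete stop = ∈-stops-chains κ (∈-stops (κ ≟κ))
  chains-complete {ν = ν} (c ▷ p) =
    ∈-++⁺ʳ (stops (ν ≟κ))
      (∈-concatMap⁺ (λ b → List.map (extend b) (chains (lower b)))
        (lose (below-complete ν (_ because p)) (∈-map⁺ _ (chains-complete c))))

-- By chains-unique and chains-complete this is the cardinality of Chain κ ν.
Dim⟨_,_⟩ : ∀ K N → Sig K → Sig N → ℕ
Dim⟨ K , N ⟩ κ ν = length (chains κ ν)

-- The position of an entry, counted from one.
pos : ∀ {N} → Fin N → ℤ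
pos i = + suc (toℕ i)

inject-< : ∀ {N} (j : Fin N) (i : Fin′ j) → toℕ (inject i) ℕ.< toℕ j
inject-< j i = subst (ℕ._< toℕ j) (sym (Fin.toℕ-inject i)) (Fin.toℕ<n i)

weylFactor : ∀ {N} → Sig N → (j : Fin N) → Fin′ j → ℚ
weylFactor ν j i′ =
  (ν ! i ℤ.- ν ! j ℤ.- pos i ℤ.+ pos j) / (toℕ j ℕ.∸ toℕ i)
  where
  i = inject i′
  instance
    j∸i≢0 : ℕ.NonZero (toℕ j ℕ.∸ toℕ i)
    j∸i≢0 = ℕ.>-nonZero (ℕ.m<n⇒0<n∸m (inject-< j i′))

∏ℚ : ∀ {n} → Vector ℚ n → ℚ
∏ℚ = foldr ℚ._*_ 1ℚ

-- Weyl's dimension: the inner index i runs over the positions before j.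
Dim : ∀ {N} → Sig N → ℚ
Dim ν = ∏ℚ λ j → ∏ℚ λ i → weylFactor ν j i

/-positive : ∀ z d .{{_ : ℕ.NonZero d}} → + 0 ℤ.< z → ℚ.Positive (z / d)
/-positive (+ suc n) d _ = ℚ.normalize-pos (suc n) d
/-positive (+ zero) d (ℤ.+<+ ())

∏ℚ-positive : ∀ {n} (f : Vector ℚ n) → (∀ i → ℚ.Positive (f i)) → ℚ.Positive (∏ℚ f)
∏ℚ-positive {zero}  f p = _
∏ℚ-positive {suc n} f p =
  ℚ.pos*pos⇒pos (f zero) {{p zero}} (∏ℚ (f ∘ suc)) {{∏ℚ-positive (f ∘ suc) (p ∘ suc)}}

weylFactor-positive : ∀ {N} (ν : Sig N) j i → ℚ.Positive (weylFactor ν j i)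
weylFactor-positive ν j i′ = /-positive _ _ {{_}} 0<num
  where
  i = inject i′

  ν-diff : + 0 ≤ ν ! i ℤ.- ν ! j
  ν-diff = ℤ.i≤j⇒0≤j-i
    (Linked.lookup⁺ (λ p q → ℤ.≤-trans q p) (decreasing ν) (inject-< j i′))

  pos-diff : + 0 ℤ.< ℤ.- pos i ℤ.+ pos j
  pos-diff = subst (ℤ._< ℤ.- pos i ℤ.+ pos j) (ℤ.+-inverseˡ (pos i))
    (ℤ.+-monoʳ-< (ℤ.- pos i) (ℤ.+<+ (ℕ.s≤s (inject-< j i′))))

  0<num : + 0 ℤ.< ν ! i ℤ.- ν ! j ℤ.- pos i ℤ.+ pos j
  0<num = subst (+ 0 ℤ.<_)
    (sym (ℤ.+-assoc (ν ! i ℤ.- ν ! j) (ℤ.- pos i) (pos j)))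
    (ℤ.+-mono-≤-< ν-diff pos-diff)

Dim-positive : ∀ {N} (ν : Sig N) → ℚ.Positive (Dim ν)
Dim-positive ν = ∏ℚ-positive _ λ j → ∏ℚ-positive _ (weylFactor-positive ν j)

Dim-nonZero : ∀ {N} (ν : Sig N) → ℚ.NonZero (Dim ν)
Dim-nonZero ν = ℚ.pos⇒nonZero (Dim ν) {{Dim-positive ν}}

F : ∀ {N} → ℤ → Sig N → ℚ
F {N} k ν = ((+ Dim⟨ 1 , N ⟩ (singleton k) ν / 1) ÷ Dim ν) {{Dim-nonZero ν}}

-- Polynomials in t over ℚ, as lists of coefficients, constant term first.
Poly : Set
Poly = List ℚ

coeff : Poly → ℕ → ℚ
coeff []      _       = 0ℚ
coeff (a ∷ p) zero    = a
coeff (a ∷ p) (suc n) = coeff p n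

infix  4 _≈ₚ_
infixl 6 _+ₚ_
infixl 7 _*ₚ_ _·ₚ_

-- Trailing zero coefficients are not significant.
_≈ₚ_ : Poly → Poly → Set
p ≈ₚ q = ∀ n → coeff p n ≡ coeff q n

0ₚ 1ₚ : Poly
0ₚ = []
1ₚ = 1ℚ ∷ []

_+ₚ_ : Poly → Poly → Poly
[]      +ₚ q       = q
p       +ₚ []      = p
(a ∷ p) +ₚ (b ∷ q) = (a ℚ.+ b) ∷ (p +ₚ q)

_·ₚ_ : ℚ → Poly → Poly
a ·ₚ p = List.map (a ℚ.*_) p

_*ₚ_ : Poly → Poly → Poly
[]      *ₚ q = 0ₚ
(a ∷ p) *ₚ q = a ·ₚ q +ₚ (0ℚ ∷ p *ₚ q)

∏ₚ : ∀ {n} → Vector Poly n → Poly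
∏ₚ = foldr _*ₚ_ 1ₚ

-- The polynomial t + a.
t+_ : ℤ → Poly
t+ a = a / 1 ∷ 1ℚ ∷ []

coeff-+ : ∀ p q n → coeff (p +ₚ q) n ≡ coeff p n ℚ.+ coeff q n
coeff-+ []      q       n       = sym (ℚ.+-identityˡ (coeff q n))
coeff-+ (a ∷ p) []      n       = sym (ℚ.+-identityʳ (coeff (a ∷ p) n))
coeff-+ (a ∷ p) (b ∷ q) zero    = refl
coeff-+ (a ∷ p) (b ∷ q) (suc n) = coeff-+ p q n

coeff-· : ∀ a p n → coeff (a ·ₚ p) n ≡ a ℚ.* coeff p n
coeff-· a []      n       = sym (ℚ.*-zeroʳ a)
coeff-· a (b ∷ p) zero    = refl
coeff-· a (b ∷ p) (suc n) = coeff-· a p n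

coeff-∷* : ∀ a p q n →
           coeff ((a ∷ p) *ₚ q) n ≡ a ℚ.* coeff q n ℚ.+ coeff (0ℚ ∷ p *ₚ q) n
coeff-∷* a p q n =
  trans (coeff-+ (a ·ₚ q) _ n) (cong (ℚ._+ coeff (0ℚ ∷ p *ₚ q) n) (coeff-· a q n))

coeff-*0∷ : ∀ p q n → coeff (p *ₚ (0ℚ ∷ q)) n ≡ coeff (0ℚ ∷ p *ₚ q) n
coeff-*0∷ []      q zero    = refl
coeff-*0∷ []      q (suc n) = refl
coeff-*0∷ (a ∷ p) q zero    = trans (ℚ.+-identityʳ (a ℚ.* 0ℚ)) (ℚ.*-zeroʳ a)
coeff-*0∷ (a ∷ p) q (suc n) = begin
  coeff ((a ∷ p) *ₚ (0ℚ ∷ q)) (suc n)              ≡⟨ coeff-∷* a p (0ℚ ∷ q) (suc n) ⟩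
  a ℚ.* coeff q n ℚ.+ coeff (p *ₚ (0ℚ ∷ q)) n      ≡⟨ cong (λ z → a ℚ.* coeff q n ℚ.+ z) (coeff-*0∷ p q n) ⟩
  a ℚ.* coeff q n ℚ.+ coeff (0ℚ ∷ p *ₚ q) n        ≡⟨ coeff-∷* a p q n ⟨
  coeff ((a ∷ p) *ₚ q) n                           ∎
  where open ≡-Reasoning

*-cancel-0 : ∀ {a b} → a ≢ 0ℚ → a ℚ.* b ≡ 0ℚ → b ≡ 0ℚ
*-cancel-0 {a} {b} a≢0 ab≡0 = begin
  b                       ≡⟨ ℚ.*-identityˡ b ⟨
  1ℚ ℚ.* b                ≡⟨ cong (ℚ._* b) (ℚ.*-inverseˡ a) ⟨
  (ℚ.1/ a) ℚ.* a ℚ.* b    ≡⟨ ℚ.*-assoc (ℚ.1/ a) a b ⟩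
  (ℚ.1/ a) ℚ.* (a ℚ.* b)  ≡⟨ cong (λ z → (ℚ.1/ a) ℚ.* z) ab≡0 ⟩
  (ℚ.1/ a) ℚ.* 0ℚ         ≡⟨ ℚ.*-zeroʳ (ℚ.1/ a) ⟩
  0ℚ                      ∎
  where
  open ≡-Reasoning
  instance
    a-nonZero : ℚ.NonZero a
    a-nonZero = ℚ.≢-nonZero a≢0

*ₚ-cancel-0 : ∀ {a} p q → a ≢ 0ℚ → (a ∷ p) *ₚ q ≈ₚ 0ₚ → q ≈ₚ 0ₚ
*ₚ-cancel-0 {a} p []      a≢0 eq n = refl
*ₚ-cancel-0 {a} p (b ∷ q) a≢0 eq
  with *-cancel-0 a≢0 (trans (sym (ℚ.+-identityʳ (a ℚ.* b))) (eq zero))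
... | refl = λ where
  zero    → refl
  (suc n) → *ₚ-cancel-0 p q a≢0 (λ m → trans (sym (coeff-*0∷ (a ∷ p) q (suc m))) (eq (suc m))) n

*ₚ-nonZero : ∀ p q → ¬ p ≈ₚ 0ₚ → ¬ q ≈ₚ 0ₚ → ¬ p *ₚ q ≈ₚ 0ₚ
*ₚ-nonZero []      q p≉0 q≉0 _  = p≉0 λ _ → refl
*ₚ-nonZero (a ∷ p) q p≉0 q≉0 eq with a ℚ.≟ 0ℚ
... | no a≢0   = q≉0 (*ₚ-cancel-0 p q a≢0 eq)
... | yes refl = *ₚ-nonZero p q (λ p≈0 → p≉0 λ { zero → refl ; (suc n) → p≈0 n }) q≉0 λ n → begin
  coeff (p *ₚ q) n                                   ≡⟨ ℚ.+-identityˡ _ ⟨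
  0ℚ ℚ.+ coeff (p *ₚ q) n                            ≡⟨ cong (ℚ._+ coeff (p *ₚ q) n) (ℚ.*-zeroˡ (coeff q (suc n))) ⟨
  0ℚ ℚ.* coeff q (suc n) ℚ.+ coeff (p *ₚ q) n        ≡⟨ coeff-∷* 0ℚ p q (suc n) ⟨
  coeff ((0ℚ ∷ p) *ₚ q) (suc n)                      ≡⟨ eq (suc n) ⟩
  0ℚ                                                 ∎
  where open ≡-Reasoning

1ₚ-nonZero : ¬ 1ₚ ≈ₚ 0ₚ
1ₚ-nonZero eq with () ← eq zero

t+-nonZero : ∀ a → ¬ t+ a ≈ₚ 0ₚ
t+-nonZero a eq with () ← eq 1

∏ₚ-nonZero : ∀ {n} (p : Vector Poly n) → (∀ i → ¬ p i ≈ₚ 0ₚ) → ¬ ∏ₚ p ≈ₚ 0ₚ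
∏ₚ-nonZero {zero}  p p≉0 = 1ₚ-nonZero
∏ₚ-nonZero {suc n} p p≉0 =
  *ₚ-nonZero (p zero) (∏ₚ (p ∘ suc)) (p≉0 zero) (∏ₚ-nonZero (p ∘ suc) (p≉0 ∘ suc))

-- ℚ(t) as formal fractions, with equality by cross-multiplication.
record RatFun : Set where
  constructor frac
  field
    num den : Poly
    .den≉0  : ¬ den ≈ₚ 0ₚ

open RatFun public

infix  4 _≈_
infixl 6 _+_
infixl 7 _*_

_≈_ : RatFun → RatFun → Set
f ≈ g = num f *ₚ den g ≈ₚ num g *ₚ den f

const : ℚ → RatFun
const a = frac (a ∷ []) 1ₚ 1ₚ-nonZero

0# 1# : RatFun
0# = const 0ℚ
1# = const 1ℚ

_+_ : RatFun → RatFun → RatFun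
frac p q q≉0 + frac r s s≉0 =
  frac (p *ₚ s +ₚ r *ₚ q) (q *ₚ s) (*ₚ-nonZero q s q≉0 s≉0)

_*_ : RatFun → RatFun → RatFun
frac p q q≉0 * frac r s s≉0 = frac (p *ₚ r) (q *ₚ s) (*ₚ-nonZero q s q≉0 s≉0)

∏ : ∀ {n} → Vector RatFun n → RatFun
∏ = foldr _*_ 1#

∑ : List ℤ → (ℤ → RatFun) → RatFun
∑ ks f = List.foldr _+_ 0# (List.map f ks)

-- s is the sum of the finitely supported family f over all of ℤ.
record IsSumOverℤ (f : ℤ → RatFun) (s : RatFun) : Set where
  field
    support   : List ℤ
    unique    : Unique support
    vanishing : ∀ k → k ∉ support → f k ≈ 0#
    total     : s ≈ ∑ support f

H* : ∀ {N} → Sig N → RatFun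
H* ν = ∏ λ j → frac (t+ pos j) (t+ (pos j ℤ.- ν ! j)) (t+-nonZero (pos j ℤ.- ν ! j))

-- The polynomial (t+1-k)(t+2-k)⋯(t+N-k).
shifted : ℕ → ℤ → Poly
shifted N k = ∏ₚ {N} λ j → t+ (pos j ℤ.- k)

shifted-nonZero : ∀ N k → ¬ shifted N k ≈ₚ 0ₚ
shifted-nonZero N k = ∏ₚ-nonZero {N} _ λ j → t+-nonZero (pos j ℤ.- k)

-- (t+1)(t+2)⋯(t+N) / ((t+1-k)(t+2-k)⋯(t+N-k))
kernel : ℕ → ℤ → RatFun
kernel N k = frac (∏ₚ {N} λ j → t+ pos j) (shifted N k) (shifted-nonZero N k)

{-# OPTIONS --safe #-}

-- Put p_i = i - ν_i, an increasing sequence. Interlacing λ ≺ ν says that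
-- i - λ_i runs independently over [p_i, p_{i+1}), so summing an alternant
-- det (Δ f_i) over the signatures below ν telescopes row by row and gives the
-- alternant of the f_i, with an additional column of ones, at the p_i. Since
-- Δ (y choose a+1) = (y choose a), induction on N = n + 1 yields, for every
-- function G on ℤ,
--   Σ_k Dim_{1,N}(k,ν) (Δⁿ G)(1 - k) = det ((p_i choose 0), …, (p_i choose n-1), G(p_i)).
-- For G(y) = 1 / (t + y) the left-hand side consists of the kernels of the
-- theorem, and repeated divided differences evaluate the determinant as a
-- multiple of Dim ν / ∏ (t + p_i). An identity of rational functions follows
-- from its values at the half-integers, where no denominator vanishes.

module Submission where

open import Defs
open import Algebra.Properties.Group using (∙-cancelʳ)
open import Data.Nat.Base as ℕ using (ℕ; zero; suc)
import Data.Nat.Properties as ℕ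
open import Data.Fin.Base using (Fin; zero; suc; fromℕ; toℕ; inject)
open import Data.Integer.Base as ℤ using (ℤ; _≤_; _≥_; +_)
import Data.Integer.Properties as ℤ
open import Data.Integer.Tactic.RingSolver using () renaming (ring to ℤ-ring)
open import Data.List.Base as List using (List; []; _∷_; _++_; [_]; map)
import Data.List.Properties as List
open import Data.List.Membership.Propositional using (_∈_)
open import Data.List.Relation.Unary.Any using (here; there)
open import Data.List.Relation.Unary.Unique.Propositional using (Unique)
open import Data.List.Relation.Unary.AllPairs using ([]; _∷_)
open import Data.List.Relation.Binary.Pointwise as Pointwise using (Pointwise; []; _∷_)
open import Data.List.Relation.Unary.All as All using (All; []; _∷_)
import Data.List.Relation.Unary.All.Properties as All
open import Data.Rational.Base as ℚ using (ℚ; 0ℚ; 1ℚ; _/_)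
  renaming (_+_ to infixl 6 _+ℚ_; _*_ to infixl 7 _*ℚ_; _-_ to infixl 6 _-ℚ_)
import Data.Rational.Properties as ℚ
open import Data.Rational.Unnormalised.Base using (mkℚᵘ; *≡*)
import Data.Rational.Unnormalised.Properties as ℚᵘ
open import Data.Vec.Base using (Vec; []; _∷_; lookup)
open import Data.Vec.Relation.Unary.Linked as Linked using (Linked; []; [-]; _∷_)
open import Data.Product.Base using (_×_; _,_; ∃; proj₁; proj₂)
open import Function.Base using (_∘_)
open import Level using (0ℓ)
open import Relation.Binary.PropositionalEquality
  using (_≡_; _≢_; refl; sym; trans; cong; cong₂; subst; module ≡-Reasoning)
open import Relation.Nullary using (¬_; Dec; yes; no; contradiction; recompute)
open import Relation.Nullary.Decidable using (dec⇒maybe)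
open import Tactic.RingSolver using (solve-∀)
open import Tactic.RingSolver.Core.AlmostCommutativeRing using (AlmostCommutativeRing; fromCommutativeRing)

open ≡-Reasoning

-- Points of an alternant may have any type, since only the values f(x) enter. A sum of alternants
-- over a box is therefore again an alternant, whose points are the ranges, and telescoping turns
-- each range into a formal difference of two neighbouring integers. Both halves of the argument
-- rest on one row operation, the exchange of a constant column for differences of rows: the
-- summation reads it from differences to points, the evaluation of the determinant from points to
-- differences. The function 1/(t + y) fits both halves. Its n-th difference is, up to the factor
-- (-1)^n n!, a product of n + 1 consecutive reciprocals, as in the kernels; its divided differences
-- are constant multiples of itself, so the last column keeps its shape while the polynomial columns
-- lose a degree. With a number in place of t all of this is arithmetic in ℚ, instead of arithmetic
-- with fractions under cross-multiplied equality.

private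
  variable
    A B : Set

ℚ-ring : AlmostCommutativeRing 0ℓ 0ℓ
ℚ-ring = fromCommutativeRing ℚ.+-*-commutativeRing λ x → dec⇒maybe (0ℚ ℚ.≟ x)

-- Ring identities, finite sums and products over lists

+-interchange : ∀ a b c d → (a +ℚ b) +ℚ (c +ℚ d) ≡ (a +ℚ c) +ℚ (b +ℚ d)
+-interchange = solve-∀ ℚ-ring

*-interchange : ∀ a b c d → a *ℚ b *ℚ (c *ℚ d) ≡ a *ℚ c *ℚ (b *ℚ d)
*-interchange = solve-∀ ℚ-ring

+-‿-‿interchange : ∀ a b c d → (a -ℚ b) +ℚ (c -ℚ d) ≡ (a +ℚ c) -ℚ (b +ℚ d)
+-‿-‿interchange = solve-∀ ℚ-ring

-‿-‿interchange : ∀ a b c d → (a -ℚ b) -ℚ (c -ℚ d) ≡ (a -ℚ c) -ℚ (b -ℚ d)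
-‿-‿interchange = solve-∀ ℚ-ring

sum : (A → ℚ) → List A → ℚ
sum f []       = 0ℚ
sum f (x ∷ xs) = f x +ℚ sum f xs

product : (A → ℚ) → List A → ℚ
product f []       = 1ℚ
product f (x ∷ xs) = f x *ℚ product f xs

sum-cong : {f g : A → ℚ} → (∀ x → f x ≡ g x) → ∀ xs → sum f xs ≡ sum g xs
sum-cong f≡g []       = refl
sum-cong f≡g (x ∷ xs) = cong₂ _+ℚ_ (f≡g x) (sum-cong f≡g xs)

sum-0 : ∀ (xs : List A) → sum (λ _ → 0ℚ) xs ≡ 0ℚ
sum-0 []       = refl
sum-0 (x ∷ xs) = trans (ℚ.+-identityˡ _) (sum-0 xs)

sum-+ : ∀ (f g : A → ℚ) xs → sum (λ x → f x +ℚ g x) xs ≡ sum f xs +ℚ sum g xs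
sum-+ f g []       = refl
sum-+ f g (x ∷ xs) = trans (cong (f x +ℚ g x +ℚ_) (sum-+ f g xs)) (+-interchange (f x) (g x) _ _)

sum-*ˡ : ∀ c (f : A → ℚ) xs → sum (λ x → c *ℚ f x) xs ≡ c *ℚ sum f xs
sum-*ˡ c f []       = sym (ℚ.*-zeroʳ c)
sum-*ˡ c f (x ∷ xs) = trans (cong (c *ℚ f x +ℚ_) (sum-*ˡ c f xs)) (sym (ℚ.*-distribˡ-+ c _ _))

sum-*ʳ : ∀ c (f : A → ℚ) xs → sum (λ x → f x *ℚ c) xs ≡ sum f xs *ℚ c
sum-*ʳ c f xs = trans (sum-cong (λ x → ℚ.*-comm (f x) c) xs) (trans (sum-*ˡ c f xs) (ℚ.*-comm c _))

sum-‿- : ∀ (f g : A → ℚ) xs → sum (λ x → f x -ℚ g x) xs ≡ sum f xs -ℚ sum g xs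
sum-‿- f g []       = refl
sum-‿- f g (x ∷ xs) =
  trans (cong (f x -ℚ g x +ℚ_) (sum-‿- f g xs)) (+-‿-‿interchange (f x) (g x) _ _)

sum-swap : ∀ (f : A → B → ℚ) xs ys →
           sum (λ x → sum (f x) ys) xs ≡ sum (λ y → sum (λ x → f x y) xs) ys
sum-swap f []       ys = sym (sum-0 ys)
sum-swap f (x ∷ xs) ys = begin
  sum (f x) ys +ℚ sum (λ x → sum (f x) ys) xs            ≡⟨ cong (sum (f x) ys +ℚ_) (sum-swap f xs ys) ⟩
  sum (f x) ys +ℚ sum (λ y → sum (λ x → f x y) xs) ys    ≡⟨ sum-+ (f x) _ ys ⟨
  sum (λ y → f x y +ℚ sum (λ x → f x y) xs) ys           ∎

sum-++ : ∀ (f : A → ℚ) xs ys → sum f (xs ++ ys) ≡ sum f xs +ℚ sum f ys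
sum-++ f []       ys = sym (ℚ.+-identityˡ _)
sum-++ f (x ∷ xs) ys = trans (cong (f x +ℚ_) (sum-++ f xs ys)) (sym (ℚ.+-assoc (f x) _ _))

sum-map : ∀ (f : B → ℚ) (g : A → B) xs → sum f (map g xs) ≡ sum (f ∘ g) xs
sum-map f g []       = refl
sum-map f g (x ∷ xs) = cong (f (g x) +ℚ_) (sum-map f g xs)

-- Alternants

-- The sum of (-1)^i h(x_i, the list without x_i), that is, one Laplace expansion with an arbitrary
-- minor h. Elements already passed are absorbed into h, so inductions over the list have to treat
-- all h at once.
altSum : (A → List A → ℚ) → List A → ℚ
altSum h []       = 0ℚ
altSum h (x ∷ xs) = h x xs -ℚ altSum (λ y ys → h y (x ∷ ys)) xs

-- det (f_i (x_j)), by Laplace expansion; zero if the lengths differ.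
alternant : List (A → ℚ) → List A → ℚ
alternant []       []       = 1ℚ
alternant []       (_ ∷ _)  = 0ℚ
alternant (f ∷ fs) xs       = altSum (λ x ys → f x *ℚ alternant fs ys) xs

altSum-cong : {h k : A → List A → ℚ} → (∀ x xs → h x xs ≡ k x xs) →
              ∀ xs → altSum h xs ≡ altSum k xs
altSum-cong h≡k []       = refl
altSum-cong h≡k (x ∷ xs) =
  cong₂ _-ℚ_ (h≡k x xs) (altSum-cong (λ y ys → h≡k y (x ∷ ys)) xs)

altSum-*ˡ : ∀ c (h : A → List A → ℚ) xs →
            altSum (λ x ys → c *ℚ h x ys) xs ≡ c *ℚ altSum h xs
altSum-*ˡ c h []       = sym (ℚ.*-zeroʳ c)
altSum-*ˡ c h (x ∷ xs) =
  trans (cong (c *ℚ h x xs -ℚ_) (altSum-*ˡ c _ xs)) (distrib c (h x xs) _)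
  where
  distrib : ∀ c a b → c *ℚ a -ℚ c *ℚ b ≡ c *ℚ (a -ℚ b)
  distrib = solve-∀ ℚ-ring

altSum-‿- : ∀ (h k : A → List A → ℚ) xs →
            altSum (λ x ys → h x ys -ℚ k x ys) xs ≡ altSum h xs -ℚ altSum k xs
altSum-‿- h k []       = refl
altSum-‿- h k (x ∷ xs) =
  trans (cong (h x xs -ℚ k x xs -ℚ_) (altSum-‿- _ _ xs)) (-‿-‿interchange (h x xs) (k x xs) _ _)

altSum-+ : ∀ (h k : A → List A → ℚ) xs →
           altSum (λ x ys → h x ys +ℚ k x ys) xs ≡ altSum h xs +ℚ altSum k xs
altSum-+ h k []       = refl
altSum-+ h k (x ∷ xs) =
  trans (cong (h x xs +ℚ k x xs -ℚ_) (altSum-+ _ _ xs)) (sym (+-‿-‿interchange (h x xs) _ (k x xs) _))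

altSum-vanish : ∀ {h : A → List A → ℚ} {xs} →
                All (λ x → ∀ ys → h x ys ≡ 0ℚ) xs → altSum h xs ≡ 0ℚ
altSum-vanish []                   = refl
altSum-vanish {xs = _ ∷ xs} (p ∷ ps) =
  cong₂ _-ℚ_ (p xs) (altSum-vanish (All.map (λ p ys → p (_ ∷ ys)) ps))

sum-altSum : ∀ (h : A → B → List B → ℚ) xs ys →
             sum (λ x → altSum (h x) ys) xs ≡ altSum (λ y zs → sum (λ x → h x y zs) xs) ys
sum-altSum h []       ys = sym (altSum-vanish (All.universal (λ _ _ → refl) ys))
sum-altSum h (x ∷ xs) ys = begin
  altSum (h x) ys +ℚ sum (λ x → altSum (h x) ys) xs                  ≡⟨ cong (altSum (h x) ys +ℚ_) (sum-altSum h xs ys) ⟩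
  altSum (h x) ys +ℚ altSum (λ y zs → sum (λ x → h x y zs) xs) ys    ≡⟨ altSum-+ (h x) _ ys ⟨
  altSum (λ y zs → h x y zs +ℚ sum (λ x → h x y zs) xs) ys           ∎

pointwise-map : ∀ {C : Set} {R : A → B → Set} (g : C → A) (h : C → B) → (∀ z → R (g z) (h z)) → ∀ zs →
                Pointwise R (map g zs) (map h zs)
pointwise-map g h r []       = []
pointwise-map g h r (z ∷ zs) = r z ∷ pointwise-map g h r zs

pointwise-mapʳ : {R : A → B → Set} (h : A → B) → (∀ x → R x (h x)) → ∀ xs →
                 Pointwise R xs (map h xs)
pointwise-mapʳ h r []       = []
pointwise-mapʳ h r (x ∷ xs) = r x ∷ pointwise-mapʳ h r xs

module _ (S : A → B → Set) where

  altSum-param : ∀ {h k} → (∀ {x y xs ys} → S x y → Pointwise S xs ys → h x xs ≡ k y ys) →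
                 ∀ {xs ys} → Pointwise S xs ys → altSum h xs ≡ altSum k ys
  altSum-param h≡k []       = refl
  altSum-param h≡k (s ∷ ss) =
    cong₂ _-ℚ_ (h≡k s ss) (altSum-param (λ t ts → h≡k t (s ∷ ts)) ss)

  -- Only the matrix of values f(x) matters, so points and functions can be exchanged for others of
  -- a different type. This is the passage between integers, ranges of integers and rows.
  alternant-param : ∀ {fs gs} → Pointwise (λ f g → ∀ {x y} → S x y → f x ≡ g y) fs gs →
                    ∀ {xs ys} → Pointwise S xs ys → alternant fs xs ≡ alternant gs ys
  alternant-param []       []      = refl
  alternant-param []       (_ ∷ _) = refl
  alternant-param (r ∷ rs) ss      =
    altSum-param (λ t ts → cong₂ _*ℚ_ (r t) (alternant-param rs ts)) ss

-- Whichever element is removed, putting it back restores the same product, so `product w` is a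
-- common factor of all terms.
altSum-product : ∀ (w : A → ℚ) (h : A → List A → ℚ) xs →
                 altSum (λ x ys → product w (x ∷ ys) *ℚ h x ys) xs ≡ product w xs *ℚ altSum h xs
altSum-product w h []       = refl
altSum-product w h (x ∷ xs) = begin
  p *ℚ h x xs -ℚ altSum (λ y ys → product w (y ∷ x ∷ ys) *ℚ h y (x ∷ ys)) xs
    ≡⟨ cong (p *ℚ h x xs -ℚ_) (altSum-cong (λ y ys → rearrange (w y) (w x) (product w ys) (h y (x ∷ ys))) xs) ⟩
  p *ℚ h x xs -ℚ altSum (λ y ys → product w (y ∷ ys) *ℚ (w x *ℚ h y (x ∷ ys))) xs
    ≡⟨ cong (p *ℚ h x xs -ℚ_) (trans (altSum-product w _ xs) (cong (product w xs *ℚ_) (altSum-*ˡ (w x) _ xs))) ⟩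
  p *ℚ h x xs -ℚ product w xs *ℚ (w x *ℚ altSum (λ y ys → h y (x ∷ ys)) xs)
    ≡⟨ factor (w x) (product w xs) (h x xs) _ ⟩
  p *ℚ altSum h (x ∷ xs) ∎
  where
  p = product w (x ∷ xs)

  rearrange : ∀ a b c d → a *ℚ (b *ℚ c) *ℚ d ≡ a *ℚ c *ℚ (b *ℚ d)
  rearrange = solve-∀ ℚ-ring

  factor : ∀ a b c d → a *ℚ b *ℚ c -ℚ b *ℚ (a *ℚ d) ≡ a *ℚ b *ℚ (c -ℚ d)
  factor = solve-∀ ℚ-ring

alternant-scale : ∀ (w : A → ℚ) fs xs →
                  alternant (map (λ f x → w x *ℚ f x) fs) xs ≡ product w xs *ℚ alternant fs xs
alternant-scale w []       []       = refl
alternant-scale w []       (x ∷ xs) = sym (ℚ.*-zeroʳ (product w (x ∷ xs)))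
alternant-scale w (f ∷ fs) xs       = begin
  altSum (λ x ys → w x *ℚ f x *ℚ alternant (map (λ f x → w x *ℚ f x) fs) ys) xs
    ≡⟨ altSum-cong (λ x ys → trans (cong (w x *ℚ f x *ℚ_) (alternant-scale w fs ys)) (*-interchange (w x) (f x) _ _)) xs ⟩
  altSum (λ x ys → product w (x ∷ ys) *ℚ (f x *ℚ alternant fs ys)) xs
    ≡⟨ altSum-product w _ xs ⟩
  product w xs *ℚ alternant (f ∷ fs) xs ∎

-- Alternants summed over boxes

box : (List A → ℚ) → List (List A) → ℚ
box h []       = h []
box h (X ∷ Xs) = sum (λ x → box (λ xs → h (x ∷ xs)) Xs) X

box-cong : {h k : List A → ℚ} → (∀ xs → h xs ≡ k xs) → ∀ Xs → box h Xs ≡ box k Xs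
box-cong h≡k []       = h≡k []
box-cong h≡k (X ∷ Xs) = sum-cong (λ x → box-cong (λ xs → h≡k (x ∷ xs)) Xs) X

box-‿- : ∀ (h k : List A → ℚ) Xs → box (λ xs → h xs -ℚ k xs) Xs ≡ box h Xs -ℚ box k Xs
box-‿- h k []       = refl
box-‿- h k (X ∷ Xs) = trans (sum-cong (λ x → box-‿- _ _ Xs) X) (sum-‿- _ _ X)

box-*ˡ : ∀ c (h : List A → ℚ) Xs → box (λ xs → c *ℚ h xs) Xs ≡ c *ℚ box h Xs
box-*ˡ c h []       = refl
box-*ˡ c h (X ∷ Xs) = trans (sum-cong (λ x → box-*ˡ c _ Xs) X) (sum-*ˡ c _ X)

box-0 : ∀ (Xs : List (List A)) → box (λ _ → 0ℚ) Xs ≡ 0ℚ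
box-0 []       = refl
box-0 (X ∷ Xs) = trans (sum-cong (λ _ → box-0 Xs) X) (sum-0 X)

box-altSum : ∀ (h : A → List A → ℚ) Xs →
             box (altSum h) Xs ≡ altSum (λ X Ys → sum (λ x → box (h x) Ys) X) Xs
box-altSum h []       = refl
box-altSum h (X ∷ Xs) = begin
  sum (λ x → box (λ xs → h x xs -ℚ altSum (λ y ys → h y (x ∷ ys)) xs) Xs) X
    ≡⟨ sum-cong (λ x → trans (box-‿- _ _ Xs) (cong (box (h x) Xs -ℚ_) (box-altSum _ Xs))) X ⟩
  sum (λ x → box (h x) Xs -ℚ altSum (λ Y Ys → sum (λ y → box (λ ys → h y (x ∷ ys)) Ys) Y) Xs) X
    ≡⟨ sum-‿- _ _ X ⟩
  sum (λ x → box (h x) Xs) X -ℚ sum (λ x → altSum (λ Y Ys → sum (λ y → box (λ ys → h y (x ∷ ys)) Ys) Y) Xs) X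
    ≡⟨ cong (sum (λ x → box (h x) Xs) X -ℚ_)
         (trans (sum-altSum _ X Xs) (altSum-cong (λ Y Ys → sum-swap _ X Y) Xs)) ⟩
  sum (λ x → box (h x) Xs) X -ℚ altSum (λ Y Ys → sum (λ y → box (h y) (X ∷ Ys)) Y) Xs ∎

-- A determinant is linear in every row and the j-th row involves only the j-th coordinate, so the
-- sum over the box sums each row separately. The lists themselves become the points.
box-alternant : ∀ (fs : List (A → ℚ)) Xs → box (alternant fs) Xs ≡ alternant (map sum fs) Xs
box-alternant []       []       = refl
box-alternant []       (X ∷ Xs) = trans (sum-cong (λ _ → box-0 Xs) X) (sum-0 X)
box-alternant (f ∷ fs) Xs       = trans (box-altSum _ Xs) (altSum-cong expand Xs)
  where
  expand : ∀ X Ys → sum (λ x → box (λ ys → f x *ℚ alternant fs ys) Ys) X ≡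
                    sum f X *ℚ alternant (map sum fs) Ys
  expand X Ys = begin
    sum (λ x → box (λ ys → f x *ℚ alternant fs ys) Ys) X
      ≡⟨ sum-cong (λ x → trans (box-*ˡ (f x) _ Ys) (cong (f x *ℚ_) (box-alternant fs Ys))) X ⟩
    sum (λ x → f x *ℚ alternant (map sum fs) Ys) X
      ≡⟨ sum-*ʳ _ f X ⟩
    sum f X *ℚ alternant (map sum fs) Ys ∎

-- Row operations on alternants

module RowOperations {A : Set} (_⊖_ : A → A → A) where

  Linear : (A → ℚ) → Set
  Linear f = ∀ s r → f (s ⊖ r) ≡ f s -ℚ f r

  -- The properties of the summands of a Laplace expansion that make the
  -- expansion itself linear in each argument.
  Multilinear : (List A → ℚ) → Set
  Multilinear d = ∀ pre s r post →
    d (pre ++ (s ⊖ r) ∷ post) ≡ d (pre ++ s ∷ post) -ℚ d (pre ++ r ∷ post)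

  ShearInvariant : (List A → ℚ) → Set
  ShearInvariant d = ∀ pre r s post → d (pre ++ r ∷ (s ⊖ r) ∷ post) ≡ d (pre ++ r ∷ s ∷ post)

  altSum-multilinear : ∀ h → (∀ ys → Linear (λ x → h x ys)) → (∀ x → Multilinear (h x)) →
                       Multilinear (altSum h)
  altSum-multilinear h lin mul [] s r post = begin
    h (s ⊖ r) post -ℚ altSum (λ y ys → h y ((s ⊖ r) ∷ ys)) post
      ≡⟨ cong₂ _-ℚ_ (lin post s r)
           (trans (altSum-cong (λ y ys → mul y [] s r ys) post) (altSum-‿- _ _ post)) ⟩
    (h s post -ℚ h r post) -ℚ (altSum (λ y ys → h y (s ∷ ys)) post -ℚ altSum (λ y ys → h y (r ∷ ys)) post)
      ≡⟨ -‿-‿interchange (h s post) (h r post) _ _ ⟩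
    altSum h (s ∷ post) -ℚ altSum h (r ∷ post) ∎
  altSum-multilinear h lin mul (x ∷ pre) s r post = begin
    h x (pre ++ (s ⊖ r) ∷ post) -ℚ altSum h′ (pre ++ (s ⊖ r) ∷ post)
      ≡⟨ cong₂ _-ℚ_ (mul x pre s r post)
           (altSum-multilinear h′ (λ ys → lin (x ∷ ys)) (λ y p → mul y (x ∷ p)) pre s r post) ⟩
    (h x (pre ++ s ∷ post) -ℚ h x (pre ++ r ∷ post)) -ℚ (altSum h′ (pre ++ s ∷ post) -ℚ altSum h′ (pre ++ r ∷ post))
      ≡⟨ -‿-‿interchange (h x (pre ++ s ∷ post)) _ _ _ ⟩
    altSum h (x ∷ pre ++ s ∷ post) -ℚ altSum h (x ∷ pre ++ r ∷ post) ∎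
    where
    h′ = λ y ys → h y (x ∷ ys)

  -- By linearity, the terms that remove `r` and `s ⊖ r` each produce an extra term in which one `r`
  -- is removed and another is left over. Adjacency of the two rows makes the remaining lists equal
  -- and the signs opposite, so the extra terms cancel. Every other term keeps both rows and falls
  -- under `shear`.
  altSum-shear : ∀ h → (∀ ys → Linear (λ x → h x ys)) → (∀ x → Multilinear (h x)) →
                 (∀ x → ShearInvariant (h x)) → ShearInvariant (altSum h)
  altSum-shear h lin mul shear [] r s post = begin
    h r ((s ⊖ r) ∷ post) -ℚ (h (s ⊖ r) (r ∷ post) -ℚ altSum (λ y ys → h y (r ∷ (s ⊖ r) ∷ ys)) post)
      ≡⟨ cong₂ _-ℚ_ (mul r [] s r post)
           (cong₂ _-ℚ_ (lin (r ∷ post) s r) (altSum-cong (λ y ys → shear y [] r s ys) post)) ⟩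
    (h r (s ∷ post) -ℚ h r (r ∷ post)) -ℚ ((h s (r ∷ post) -ℚ h r (r ∷ post)) -ℚ altSum (λ y ys → h y (r ∷ s ∷ ys)) post)
      ≡⟨ cancel (h r (s ∷ post)) (h r (r ∷ post)) (h s (r ∷ post)) _ ⟩
    h r (s ∷ post) -ℚ (h s (r ∷ post) -ℚ altSum (λ y ys → h y (r ∷ s ∷ ys)) post) ∎
    where
    cancel : ∀ a b c d → (a -ℚ b) -ℚ ((c -ℚ b) -ℚ d) ≡ a -ℚ (c -ℚ d)
    cancel = solve-∀ ℚ-ring
  altSum-shear h lin mul shear (x ∷ pre) r s post =
    cong₂ _-ℚ_ (shear x pre r s post)
      (altSum-shear _ (λ ys → lin (x ∷ ys)) (λ y p → mul y (x ∷ p)) (λ y p → shear y (x ∷ p)) pre r s post)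

  private
    *-linearˡ : ∀ f → Linear f → ∀ c → Linear (λ x → f x *ℚ c)
    *-linearˡ f lin c s r = trans (cong (_*ℚ c) (lin s r)) (distrib (f s) (f r) c)
      where
      distrib : ∀ a b c → (a -ℚ b) *ℚ c ≡ a *ℚ c -ℚ b *ℚ c
      distrib = solve-∀ ℚ-ring

    *-multilinear : ∀ c d → Multilinear d → Multilinear (λ ys → c *ℚ d ys)
    *-multilinear c d mul pre s r post = trans (cong (c *ℚ_) (mul pre s r post)) (distrib c _ _)
      where
      distrib : ∀ c a b → c *ℚ (a -ℚ b) ≡ c *ℚ a -ℚ c *ℚ b
      distrib = solve-∀ ℚ-ring

  alternant-multilinear : ∀ {fs} → All Linear fs → Multilinear (alternant fs)
  alternant-multilinear []                   []      s r post = refl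
  alternant-multilinear []                   (_ ∷ _) s r post = refl
  alternant-multilinear (_∷_ {f} {fs} lin lins) =
    altSum-multilinear _ (λ ys → *-linearˡ f lin (alternant fs ys))
      (λ x → *-multilinear (f x) (alternant fs) (alternant-multilinear lins))

  alternant-shear : ∀ {fs} → All Linear fs → ShearInvariant (alternant fs)
  alternant-shear []                     []      r s post = refl
  alternant-shear []                     (_ ∷ _) r s post = refl
  alternant-shear (_∷_ {f} {fs} lin lins) =
    altSum-shear _ (λ ys → *-linearˡ f lin (alternant fs ys))
      (λ x → *-multilinear (f x) (alternant fs) (alternant-multilinear lins))
      (λ x pre r s post → cong (f x *ℚ_) (alternant-shear lins pre r s post))

  diffs : A → List A → List A
  diffs r []       = []
  diffs r (s ∷ ss) = (s ⊖ r) ∷ diffs s ss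

  -- Differences are undone from left to right: once `s ⊖ r` is restored to `s`, the next difference
  -- has its own subtrahend as left neighbour. `pre` collects the rows already restored.
  alternant-diffs : ∀ {fs} → All Linear fs → ∀ pre r ss →
                    alternant fs (pre ++ r ∷ diffs r ss) ≡ alternant fs (pre ++ r ∷ ss)
  alternant-diffs lin pre r []       = refl
  alternant-diffs {fs} lin pre r (s ∷ ss) = begin
    alternant fs (pre ++ r ∷ (s ⊖ r) ∷ diffs s ss)      ≡⟨ alternant-shear lin pre r s (diffs s ss) ⟩
    alternant fs (pre ++ r ∷ s ∷ diffs s ss)            ≡⟨ cong (alternant fs) (List.++-assoc pre [ r ] _) ⟨
    alternant fs ((pre ++ [ r ]) ++ s ∷ diffs s ss)     ≡⟨ alternant-diffs lin (pre ++ [ r ]) s ss ⟩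
    alternant fs ((pre ++ [ r ]) ++ s ∷ ss)             ≡⟨ cong (alternant fs) (List.++-assoc pre [ r ] _) ⟩
    alternant fs (pre ++ r ∷ s ∷ ss)                    ∎

  -- Row differences annihilate a constant column below its first entry, so a single term of the
  -- Laplace expansion along that column survives.
  alternant-constant : ∀ {e fs c} → Linear e → All Linear fs →
                       ∀ r ss → e r ≡ c → All (λ s → e s ≡ c) ss →
                       alternant (e ∷ fs) (r ∷ ss) ≡ c *ℚ alternant fs (diffs r ss)
  alternant-constant {e} {fs} {c} lin lins r ss er≡c es≡c = begin
    alternant (e ∷ fs) (r ∷ ss)
      ≡⟨ alternant-diffs {e ∷ fs} (lin ∷ lins) [] r ss ⟨
    e r *ℚ alternant fs (diffs r ss) -ℚ altSum (λ y ys → e y *ℚ alternant fs (r ∷ ys)) (diffs r ss)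
      ≡⟨ cong₂ _-ℚ_ (cong (_*ℚ alternant fs (diffs r ss)) er≡c)
           (altSum-vanish (All.map (λ p ys → trans (cong (_*ℚ alternant fs (r ∷ ys)) p) (ℚ.*-zeroˡ (alternant fs (r ∷ ys)))) (vanish r ss er≡c es≡c))) ⟩
    c *ℚ alternant fs (diffs r ss) -ℚ 0ℚ
      ≡⟨ ℚ.+-identityʳ _ ⟩
    c *ℚ alternant fs (diffs r ss) ∎
    where
    vanish : ∀ r ss → e r ≡ c → All (λ s → e s ≡ c) ss → All (λ y → e y ≡ 0ℚ) (diffs r ss)
    vanish r []       er []         = []
    vanish r (s ∷ ss) er (es ∷ ess) =
      trans (lin s r) (trans (cong₂ _-ℚ_ es er) (ℚ.+-inverseʳ c)) ∷ vanish s ss es ess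

-- Formal differences of points of A act on functions through their values.
Row : Set → Set
Row A = (A → ℚ) → ℚ

_⊖_ : Row A → Row A → Row A
(s ⊖ r) f = s f -ℚ r f

δ : A → Row A
δ x f = f x

apply : (A → ℚ) → Row A → ℚ
apply f r = r f

module _ {A : Set} where
  open RowOperations {Row A} _⊖_ public

apply-linear : ∀ (fs : List (A → ℚ)) → All Linear (map apply fs)
apply-linear fs = All.map⁺ (All.universal (λ _ _ _ → refl) fs)

alternant-δ : ∀ (fs : List (A → ℚ)) xs → alternant fs xs ≡ alternant (map apply fs) (map δ xs)
alternant-δ fs xs = alternant-param (λ x r → ∀ f → f x ≡ r f)
  (pointwise-mapʳ apply (λ f {_} {_} s → s f) fs) (pointwise-mapʳ δ (λ x f → refl) xs)

alternant-constantᶠ : ∀ {f : A → ℚ} {c} → (∀ x → f x ≡ c) → ∀ fs x xs →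
  alternant (f ∷ fs) (x ∷ xs) ≡ c *ℚ alternant (map apply fs) (diffs (δ x) (map δ xs))
alternant-constantᶠ {f = f} f≡c fs x xs = trans (alternant-δ (f ∷ fs) (x ∷ xs))
  (alternant-constant {e = apply f} (λ _ _ → refl) (apply-linear fs) (δ x) (map δ xs) (f≡c x)
    (All.map⁺ (All.universal f≡c xs)))

rows-cong : ∀ (fs : List (A → ℚ)) {rs ss} → Pointwise (λ r s → ∀ f → r f ≡ s f) rs ss →
            alternant (map apply fs) rs ≡ alternant (map apply fs) ss
rows-cong fs = alternant-param (λ r s → ∀ f → r f ≡ s f)
  (pointwise-map apply apply (λ f {_} {_} s → s f) fs)

-- Divided differences at `x` need every row relative to `x`, whereas `diffs` compares neighbours.
-- Differences of neighbours do not change when `δ x` is subtracted from all rows, so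
-- `alternant-diffs` applies to the shifted rows.
alternant-diffs-δ : ∀ (fs : List (A → ℚ)) x xs →
  alternant (map apply fs) (diffs (δ x) (map δ xs)) ≡ alternant (map (λ f y → f y -ℚ f x) fs) xs
alternant-diffs-δ []       x []       = refl
alternant-diffs-δ (f ∷ fs) x []       = refl
alternant-diffs-δ fs       x (y ∷ ys) = begin
  alternant (map apply fs) ((δ y ⊖ δ x) ∷ diffs (δ y) (map δ ys))
    ≡⟨ rows-cong fs ((λ f → refl) ∷ shift y ys) ⟩
  alternant (map apply fs) ((δ y ⊖ δ x) ∷ diffs (δ y ⊖ δ x) (map (λ z → δ z ⊖ δ x) ys))
    ≡⟨ alternant-diffs {fs = map apply fs} (apply-linear fs) [] (δ y ⊖ δ x) _ ⟩
  alternant (map apply fs) (map (λ z → δ z ⊖ δ x) (y ∷ ys))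
    ≡⟨ alternant-param (λ z r → ∀ f → f z -ℚ f x ≡ r f)
         (pointwise-map (λ f y → f y -ℚ f x) apply (λ f {_} {_} s → s f) fs)
         (pointwise-mapʳ (λ z → δ z ⊖ δ x) (λ z f → refl) (y ∷ ys)) ⟨
  alternant (map (λ f y → f y -ℚ f x) fs) (y ∷ ys) ∎
  where
  cancel : ∀ a b c → a -ℚ b ≡ (a -ℚ c) -ℚ (b -ℚ c)
  cancel = solve-∀ ℚ-ring

  shift : ∀ y ys → Pointwise (λ r s → ∀ f → r f ≡ s f)
                     (diffs (δ y) (map δ ys)) (diffs (δ y ⊖ δ x) (map (λ z → δ z ⊖ δ x) ys))
  shift y []       = []
  shift y (z ∷ ys) = (λ f → cancel (f z) (f y) (f x)) ∷ shift z ys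

-- Integers as rationals

ι : ℤ → ℚ
ι z = z / 1

ι-+ : ∀ z w → ι (z ℤ.+ w) ≡ ι z +ℚ ι w
ι-+ z w = ℚ.toℚᵘ-injective (ℚᵘ.≃-trans (ℚ.toℚᵘ-fromℚᵘ (mkℚᵘ (z ℤ.+ w) 0))
  (ℚᵘ.≃-trans (*≡* (cross z w))
    (ℚᵘ.≃-sym (ℚᵘ.≃-trans (ℚ.toℚᵘ-homo-+ (ι z) (ι w))
      (ℚᵘ.+-cong (ℚ.toℚᵘ-fromℚᵘ (mkℚᵘ z 0)) (ℚ.toℚᵘ-fromℚᵘ (mkℚᵘ w 0)))))))
  where
  cross : ∀ z w → (z ℤ.+ w) ℤ.* (+ 1) ≡ (z ℤ.* + 1 ℤ.+ w ℤ.* + 1) ℤ.* + 1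
  cross = solve-∀ ℤ-ring

/-≡-* : ∀ z d .{{_ : ℕ.NonZero d}} → z / d ≡ ι z *ℚ (+ 1 / d)
/-≡-* z d@(suc d-1) = ℚ.toℚᵘ-injective (ℚᵘ.≃-trans (ℚ.toℚᵘ-fromℚᵘ (mkℚᵘ z d-1))
  (ℚᵘ.≃-trans (*≡* (trans (cong (λ e → z ℤ.* e) (ℤ.*-identityˡ (+ d))) (cong (ℤ._* + d) (sym (ℤ.*-identityʳ z)))))
    (ℚᵘ.≃-sym (ℚᵘ.≃-trans (ℚ.toℚᵘ-homo-* (ι z) (+ 1 / d))
      (ℚᵘ.*-cong (ℚ.toℚᵘ-fromℚᵘ (mkℚᵘ z 0)) (ℚ.toℚᵘ-fromℚᵘ (mkℚᵘ (+ 1) d-1)))))))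

recip : ℕ → ℚ
recip a = + 1 / suc a

recip-inverse : ∀ a → ι (+ suc a) *ℚ recip a ≡ 1ℚ
recip-inverse a = trans (sym (/-≡-* (+ suc a) (suc a))) (ℚ.toℚᵘ-injective
  (ℚᵘ.≃-trans (ℚ.toℚᵘ-fromℚᵘ (mkℚᵘ (+ suc a) a)) (*≡* (ℤ.*-comm (+ suc a) (+ 1)))))

ι-neg : ∀ z → ι (ℤ.- z) ≡ ℚ.- ι z
ι-neg z = inverse (ι z) (ι (ℤ.- z)) (trans (sym (ι-+ z (ℤ.- z))) (cong ι (ℤ.+-inverseʳ z)))
  where
  minus : ∀ a b → b ≡ (a +ℚ b) -ℚ a
  minus = solve-∀ ℚ-ring

  inverse : ∀ a b → a +ℚ b ≡ 0ℚ → b ≡ ℚ.- a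
  inverse a b eq = trans (minus a b) (trans (cong (_-ℚ a) eq) (ℚ.+-identityˡ _))

ι-‿- : ∀ z w → ι (z ℤ.- w) ≡ ι z -ℚ ι w
ι-‿- z w = trans (ι-+ z (ℤ.- w)) (cong (ι z +ℚ_) (ι-neg w))

-- Differences and binomial coefficients

Δ : (ℤ → ℚ) → ℤ → ℚ
Δ G y = G (ℤ.suc y) -ℚ G y

Δ^ : ℕ → (ℤ → ℚ) → ℤ → ℚ
Δ^ zero    G = G
Δ^ (suc n) G = Δ^ n (Δ G)

-- The recursion multiplies by (y - a)/(a + 1), which makes sense for negative y as well and has the
-- form that `hasLeading-*` expects.
binom : ℕ → ℤ → ℚ
binom zero    y = 1ℚ
binom (suc a) y = binom a y *ℚ (recip a *ℚ (ι y -ℚ ι (+ a)))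

Δ-binom : ∀ a y → Δ (binom (suc a)) y ≡ binom a y
Δ-binom zero y = trans (cong (λ e → 1ℚ *ℚ (1ℚ *ℚ (e -ℚ 0ℚ)) -ℚ 1ℚ *ℚ (1ℚ *ℚ (ι y -ℚ 0ℚ))) (ι-+ (+ 1) y)) (simplify (ι y))
  where
  simplify : ∀ e → 1ℚ *ℚ (1ℚ *ℚ (1ℚ +ℚ e -ℚ 0ℚ)) -ℚ 1ℚ *ℚ (1ℚ *ℚ (e -ℚ 0ℚ)) ≡ 1ℚ
  simplify = solve-∀ ℚ-ring
Δ-binom (suc a) y = begin
  binom (suc a) (ℤ.suc y) *ℚ (r′ *ℚ (ι (ℤ.suc y) -ℚ ι (+ suc a))) -ℚ b⁺ *ℚ (r′ *ℚ (ι y -ℚ ι (+ suc a)))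
    ≡⟨ cong₂ (λ c d → c *ℚ (r′ *ℚ (d -ℚ ι (+ suc a))) -ℚ b⁺ *ℚ (r′ *ℚ (ι y -ℚ ι (+ suc a)))) pascal (ι-+ (+ 1) y) ⟩
  (b⁺ +ℚ b) *ℚ (r′ *ℚ (1ℚ +ℚ ι y -ℚ ι (+ suc a))) -ℚ b⁺ *ℚ (r′ *ℚ (ι y -ℚ ι (+ suc a)))
    ≡⟨ cong (λ c → (b⁺ +ℚ b) *ℚ (r′ *ℚ (1ℚ +ℚ ι y -ℚ c)) -ℚ b⁺ *ℚ (r′ *ℚ (ι y -ℚ c))) (ι-+ (+ 1) (+ a)) ⟩
  (b⁺ +ℚ b) *ℚ (r′ *ℚ (1ℚ +ℚ ι y -ℚ (1ℚ +ℚ ι (+ a)))) -ℚ b⁺ *ℚ (r′ *ℚ (ι y -ℚ (1ℚ +ℚ ι (+ a))))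
    ≡⟨ collect b b⁺ r′ (ι y) (ι (+ a)) ⟩
  (1ℚ *ℚ (b *ℚ (ι y -ℚ ι (+ a))) +ℚ b⁺) *ℚ r′
    -- By definition (a + 1) `b⁺` = (y - a) `b`. Writing 1 as (a + 1) `r` brings this out and leaves
    -- `b⁺` times (a + 2) `r′`.
    ≡⟨ cong (λ c → (c *ℚ (b *ℚ (ι y -ℚ ι (+ a))) +ℚ b⁺) *ℚ r′) (recip-inverse a) ⟨
  (ι (+ suc a) *ℚ r *ℚ (b *ℚ (ι y -ℚ ι (+ a))) +ℚ b⁺) *ℚ r′
    ≡⟨ regroup b (ι (+ suc a)) r (ι y -ℚ ι (+ a)) r′ ⟩
  b⁺ *ℚ ((1ℚ +ℚ ι (+ suc a)) *ℚ r′)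
    ≡⟨ cong (b⁺ *ℚ_) (trans (cong (_*ℚ r′) (sym (ι-+ (+ 1) (+ suc a)))) (recip-inverse (suc a))) ⟩
  b⁺ *ℚ 1ℚ
    ≡⟨ ℚ.*-identityʳ b⁺ ⟩
  b⁺ ∎
  where
  b = binom a y
  b⁺ = binom (suc a) y
  r = recip a
  r′ = recip (suc a)

  restore : ∀ c d → c ≡ d +ℚ (c -ℚ d)
  restore = solve-∀ ℚ-ring

  pascal : binom (suc a) (ℤ.suc y) ≡ b⁺ +ℚ b
  pascal = trans (restore (binom (suc a) (ℤ.suc y)) b⁺) (cong (b⁺ +ℚ_) (Δ-binom a y))

  collect : ∀ b b⁺ r e a → (b⁺ +ℚ b) *ℚ (r *ℚ (1ℚ +ℚ e -ℚ (1ℚ +ℚ a))) -ℚ b⁺ *ℚ (r *ℚ (e -ℚ (1ℚ +ℚ a))) ≡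
                          (1ℚ *ℚ (b *ℚ (e -ℚ a)) +ℚ b⁺) *ℚ r
  collect = solve-∀ ℚ-ring

  regroup : ∀ b s r d r′ → (s *ℚ r *ℚ (b *ℚ d) +ℚ b *ℚ (r *ℚ d)) *ℚ r′ ≡
                           b *ℚ (r *ℚ d) *ℚ ((1ℚ +ℚ s) *ℚ r′)
  regroup = solve-∀ ℚ-ring

columns : ℕ → ℕ → (ℤ → ℚ) → List (ℤ → ℚ)
columns a zero    G = G ∷ []
columns a (suc n) G = binom a ∷ columns (suc a) n G

-- Interlacing as a box

-- With o = 1 these are the numbers i - ν_i, which increase and are the
-- constant terms of the denominators in H* ν.
points : ∀ {n} → ℕ → Vec ℤ n → List ℤ
points o []      = []
points o (x ∷ v) = (+ o ℤ.- x) ∷ points (suc o) v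

ranges : ∀ {n} → ℕ → Vec ℤ (suc n) → List (List ℤ)
ranges o (x ∷ [])    = []
ranges o (x ∷ y ∷ v) = map (λ k → + o ℤ.- k) (interval y x) ∷ ranges (suc o) (y ∷ v)

sum-cartesianProductWith : ∀ {C : Set} (h : C → ℚ) (g : A → B → C) xs ys →
  sum h (List.cartesianProductWith g xs ys) ≡ sum (λ x → sum (λ y → h (g x y)) ys) xs
sum-cartesianProductWith h g []       ys = refl
sum-cartesianProductWith h g (x ∷ xs) ys = trans (sum-++ h (map (g x) ys) _)
  (cong₂ _+ℚ_ (sum-map h (g x) ys) (sum-cartesianProductWith h g xs ys))

sum-interlacing : ∀ {n} h o (v : Vec ℤ (suc n)) →
                  sum (λ u → h (points o u)) (interlacing v) ≡ box h (ranges o v)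
sum-interlacing h o (x ∷ [])    = ℚ.+-identityʳ _
sum-interlacing h o (x ∷ y ∷ v) = begin
  sum (λ u → h (points o u)) (List.cartesianProductWith _∷_ (interval y x) (interlacing (y ∷ v)))
    ≡⟨ sum-cartesianProductWith _ _∷_ (interval y x) (interlacing (y ∷ v)) ⟩
  sum (λ k → sum (λ u → h ((+ o ℤ.- k) ∷ points (suc o) u)) (interlacing (y ∷ v))) (interval y x)
    ≡⟨ sum-cong (λ k → sum-interlacing (λ ps → h ((+ o ℤ.- k) ∷ ps)) (suc o) (y ∷ v)) (interval y x) ⟩
  sum (λ k → box (λ ps → h ((+ o ℤ.- k) ∷ ps)) (ranges (suc o) (y ∷ v))) (interval y x)
    ≡⟨ sum-map (λ p → box (λ ps → h (p ∷ ps)) (ranges (suc o) (y ∷ v))) (λ k → + o ℤ.- k) (interval y x) ⟨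
  box h (ranges o (x ∷ y ∷ v)) ∎

sum-telescope : ∀ (f : A → ℚ) (g : ℕ → A) (H : ℕ → ℚ) → (∀ i → f (g i) ≡ H i -ℚ H (suc i)) →
                ∀ m → sum f (List.applyUpTo g m) ≡ H 0 -ℚ H m
sum-telescope f g H eq zero    = sym (ℚ.+-inverseʳ (H 0))
sum-telescope f g H eq (suc m) =
  trans (cong₂ _+ℚ_ (eq 0) (sum-telescope f (g ∘ suc) (H ∘ suc) (eq ∘ suc) m)) (join (H 0) (H 1) _)
  where
  join : ∀ a b c → (a -ℚ b) +ℚ (b -ℚ c) ≡ a -ℚ c
  join = solve-∀ ℚ-ring

-- The values o - k fill [o - x, o + 1 - y). When `y` follows `x` in a signature, the two ends are
-- consecutive entries of `points`, and the telescoped sum is a difference of neighbouring rows.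
sum-Δ-interval : ∀ G o {x y} → y ≤ x →
                 sum (Δ G) (map (λ k → + o ℤ.- k) (interval y x)) ≡ G (+ suc o ℤ.- y) -ℚ G (+ o ℤ.- x)
sum-Δ-interval G o {x} {y} y≤x = begin
  sum (Δ G) (map (λ k → + o ℤ.- k) (interval y x))
    ≡⟨ sum-map (Δ G) (λ k → + o ℤ.- k) (interval y x) ⟩
  sum (λ k → Δ G (+ o ℤ.- k)) (interval y x)
    ≡⟨ sum-telescope (λ k → Δ G (+ o ℤ.- k)) (λ i → y ℤ.+ + i) (λ i → G (+ suc o ℤ.- (y ℤ.+ + i)))
         (λ i → cong₂ (λ a b → G a -ℚ G b) (suc-minus (+ o) (y ℤ.+ + i)) (minus-suc (+ o) y (+ i))) (suc m) ⟩
  G (+ suc o ℤ.- (y ℤ.+ + 0)) -ℚ G (+ suc o ℤ.- (y ℤ.+ + suc m))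
    ≡⟨ cong₂ (λ a b → G (+ suc o ℤ.- a) -ℚ G b) (ℤ.+-identityʳ y)
         (trans (sym (minus-suc (+ o) y (+ m))) (cong (λ e → + o ℤ.- e) (a+∣k-a∣≡k y≤x))) ⟩
  G (+ suc o ℤ.- y) -ℚ G (+ o ℤ.- x) ∎
  where
  m = ℤ.∣ x ℤ.- y ∣

  suc-minus : ∀ o z → + 1 ℤ.+ (o ℤ.- z) ≡ (+ 1 ℤ.+ o) ℤ.- z
  suc-minus = solve-∀ ℤ-ring

  minus-suc : ∀ o y i → o ℤ.- (y ℤ.+ i) ≡ (+ 1 ℤ.+ o) ℤ.- (y ℤ.+ (+ 1 ℤ.+ i))
  minus-suc = solve-∀ ℤ-ring

module _ (F : ℤ → ℚ) where

  -- Summation over a range of integers undoes Δ, turning it into the row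
  -- operation that subtracts neighbouring points.
  Telescopes : List ℤ → Row ℤ → Set
  Telescopes L r = ∀ G → sum (Δ G) L ≡ r G

  ranges-telescope : ∀ {n} o (v : Vec ℤ n) {x} → Linked _≥_ (x ∷ v) →
    Pointwise Telescopes (ranges o (x ∷ v)) (diffs (δ (+ o ℤ.- x)) (map δ (points (suc o) v)))
  ranges-telescope o []      _           = []
  ranges-telescope o (y ∷ v) (x≥y ∷ dec) =
    (λ G → sum-Δ-interval G o x≥y) ∷ ranges-telescope (suc o) v dec

  columns-Δ : ∀ a n → Pointwise (λ f g → ∀ {L r} → Telescopes L r → f L ≡ g r)
                        (map sum (columns a n (Δ F))) (map apply (columns (suc a) n F))
  columns-Δ a zero    = (λ t → t F) ∷ []
  columns-Δ a (suc n) =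
    (λ {L} t → trans (sum-cong (λ y → sym (Δ-binom a y)) L) (t (binom (suc a)))) ∷ columns-Δ (suc a) n

  sum-alternant : ∀ n {m} (v : Vec ℤ (suc m)) → Linked _≥_ v →
    sum (λ u → alternant (columns 0 n (Δ F)) (points 1 u)) (interlacing v) ≡
    alternant (columns 0 (suc n) F) (points 1 v)
  sum-alternant n (x ∷ v) dec = begin
    sum (λ u → alternant (columns 0 n (Δ F)) (points 1 u)) (interlacing (x ∷ v))
      ≡⟨ sum-interlacing (alternant (columns 0 n (Δ F))) 1 (x ∷ v) ⟩
    box (alternant (columns 0 n (Δ F))) (ranges 1 (x ∷ v))
      ≡⟨ box-alternant (columns 0 n (Δ F)) (ranges 1 (x ∷ v)) ⟩
    alternant (map sum (columns 0 n (Δ F))) (ranges 1 (x ∷ v))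
      ≡⟨ alternant-param Telescopes (columns-Δ 0 n) (ranges-telescope 1 v dec) ⟩
    alternant (map apply (columns 1 n F)) (diffs (δ (+ 1 ℤ.- x)) (map δ (points 2 v)))
      ≡⟨ ℚ.*-identityˡ _ ⟨
    1ℚ *ℚ alternant (map apply (columns 1 n F)) (diffs (δ (+ 1 ℤ.- x)) (map δ (points 2 v)))
      -- `binom 0` is the constant 1. Read from right to left, the lemma adds it as a new column and
      -- turns the differences back into points.
      ≡⟨ alternant-constantᶠ {f = binom 0} (λ _ → refl) (columns 1 n F) (+ 1 ℤ.- x) (points 2 v) ⟨
    alternant (columns 0 (suc n) F) (points 1 (x ∷ v)) ∎

-- Counting chains

count : ∀ {n} → ℤ → Sig n → ℚ
count k ν = ι (+ List.length (chains (singleton k) ν))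

length-concatMap : ∀ (f : A → List B) xs →
                   ι (+ List.length (List.concatMap f xs)) ≡ sum (λ x → ι (+ List.length (f x))) xs
length-concatMap f []       = refl
length-concatMap f (x ∷ xs) = begin
  ι (+ List.length (f x ++ List.concatMap f xs))                     ≡⟨ cong (ι ∘ +_) (List.length-++ (f x)) ⟩
  ι (+ List.length (f x) ℤ.+ + List.length (List.concatMap f xs))    ≡⟨ ι-+ (+ List.length (f x)) (+ List.length (List.concatMap f xs)) ⟩
  ι (+ List.length (f x)) +ℚ ι (+ List.length (List.concatMap f xs)) ≡⟨ cong (ι (+ List.length (f x)) +ℚ_) (length-concatMap f xs) ⟩
  sum (λ x → ι (+ List.length (f x))) (x ∷ xs)                       ∎

stops-[] : ∀ {K N} {κ : Sig K} {ν : Sig N} → K ≢ N → (d : Dec ((K , κ) ≡ (N , ν))) → stops κ d ≡ []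
stops-[] K≢N (yes refl) = contradiction refl K≢N
stops-[] K≢N (no _)     = refl

-- A chain that starts at length 1 cannot stop at length n + 2, so `stops` contributes nothing and
-- every chain has a last step.
count-suc : ∀ {n} k (ν : Sig (suc (suc n))) → count k ν ≡ sum (λ b → count k (lower b)) (below ν)
count-suc k ν = begin
  count k ν
    ≡⟨ cong (λ cs → ι (+ List.length (cs ++ steps))) (stops-[] (λ ()) (_≟κ (singleton k) ν)) ⟩
  ι (+ List.length steps)
    ≡⟨ length-concatMap (λ b → map (extend b) (chains (singleton k) (lower b))) (below ν) ⟩
  sum (λ b → ι (+ List.length (map (extend b) (chains (singleton k) (lower b))))) (below ν)
    ≡⟨ sum-cong (λ b → cong (ι ∘ +_) (List.length-map (extend b) (chains (singleton k) (lower b)))) (below ν) ⟩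
  sum (λ b → count k (lower b)) (below ν) ∎
  where
  steps = List.concatMap (λ b → map (extend b) (chains (singleton k) (lower b))) (below ν)

-- Each interlacing step can only widen the interval from the last entry to the first.
chain-bounds : ∀ {n k} {ν : Sig (suc n)} → Chain (singleton k) ν → ν ! fromℕ n ≤ k × k ≤ ν ! zero
chain-bounds stop = ℤ.≤-refl , ℤ.≤-refl
chain-bounds {zero} (() ▷ _)
chain-bounds {suc n} (_▷_ {μ = μ} {ν} c μ≺ν) with chain-bounds c | recompute (μ ≺? ν) μ≺ν
... | lo , hi | btw = ℤ.≤-trans (proj₂ (btw (fromℕ n))) lo , ℤ.≤-trans hi (proj₁ (btw zero))

count-outside : ∀ {n} k (ν : Sig (suc n)) → ¬ (ν ! fromℕ n ≤ k × k ≤ ν ! zero) → count k ν ≡ 0ℚ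
count-outside k ν out with chains (singleton k) ν
... | []    = refl
... | c ∷ _ = contradiction (chain-bounds c) out

chain-unique : ∀ {k x} (c d : Chain (singleton k) (singleton x)) → c ≡ d
chain-unique stop     stop     = refl
chain-unique (() ▷ _) _
chain-unique _        (() ▷ _)

-- The list does not evaluate, because deciding `x ≡ x` does not compute for a variable.
-- Completeness shows instead that it is not empty, and uniqueness that it has no second element.
count-self : ∀ x → count x (singleton x) ≡ 1ℚ
count-self x with chains (singleton x) (singleton x)
                | chains-unique (singleton x) (singleton x)
                | chains-complete (singleton x) (stop {κ = singleton x})
... | []        | _               | ()
... | _ ∷ []    | _               | _ = refl
... | c ∷ d ∷ _ | (c≢d ∷ _) ∷ _   | _ = contradiction (chain-unique c d) c≢d

sum-single : ∀ (f : A → ℚ) {x xs} → Unique xs → x ∈ xs → (∀ y → y ≢ x → f y ≡ 0ℚ) → sum f xs ≡ f x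
sum-single f {x} (x∉ ∷ _) (here refl) f≡0 = trans (cong (f x +ℚ_) (vanish x∉)) (ℚ.+-identityʳ (f x))
  where
  vanish : ∀ {ys} → All (x ≢_) ys → sum f ys ≡ 0ℚ
  vanish []       = refl
  vanish (p ∷ ps) = cong₂ _+ℚ_ (f≡0 _ (p ∘ sym)) (vanish ps)
sum-single f (y∉ ∷ u) (there x∈) f≡0 =
  trans (cong₂ _+ℚ_ (f≡0 _ (All.lookup y∉ x∈)) (sum-single f u x∈ f≡0)) (ℚ.+-identityˡ _)

-- Any interval containing all entries of `ν` is allowed: in the induction one range of k has to
-- serve every signature below `ν`, so that the two sums can be exchanged. `G` is general because
-- each step down replaces it by `Δ G`.
sum-count : ∀ {a b} n G (ν : Sig (suc n)) → a ≤ ν ! fromℕ n → ν ! zero ≤ b →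
            sum (λ k → count k ν *ℚ Δ^ n G (+ 1 ℤ.- k)) (interval a b) ≡
            alternant (columns 0 n G) (points 1 (entries ν))
sum-count {a} {b} zero G (sig (x ∷ []) [-]) a≤x x≤b = begin
  sum (λ k → count k (singleton x) *ℚ G (+ 1 ℤ.- k)) (interval a b)
    ≡⟨ sum-single (λ k → count k (singleton x) *ℚ G (+ 1 ℤ.- k)) (interval-unique a b) (interval⁺ a≤x x≤b) vanish ⟩
  count x (singleton x) *ℚ G (+ 1 ℤ.- x)
    ≡⟨ cong (_*ℚ G (+ 1 ℤ.- x)) (count-self x) ⟩
  1ℚ *ℚ G (+ 1 ℤ.- x)
    ≡⟨ simplify (G (+ 1 ℤ.- x)) ⟩
  alternant (G ∷ []) ((+ 1 ℤ.- x) ∷ []) ∎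
  where
  vanish : ∀ k → k ≢ x → count k (singleton x) *ℚ G (+ 1 ℤ.- k) ≡ 0ℚ
  vanish k k≢x = trans
    (cong (_*ℚ G (+ 1 ℤ.- k)) (count-outside k (singleton x) λ (x≤k , k≤x) → k≢x (ℤ.≤-antisym k≤x x≤k)))
    (ℚ.*-zeroˡ (G (+ 1 ℤ.- k)))

  simplify : ∀ g → 1ℚ *ℚ g ≡ g *ℚ 1ℚ -ℚ 0ℚ
  simplify = solve-∀ ℚ-ring
sum-count {a} {b} (suc n) G ν a≤ ≤b = begin
  sum (λ k → count k ν *ℚ g k) (interval a b)
    ≡⟨ sum-cong (λ k → trans (cong (_*ℚ g k) (count-suc k ν)) (sym (sum-*ʳ (g k) _ (below ν)))) (interval a b) ⟩
  sum (λ k → sum (λ c → count k (lower c) *ℚ g k) (below ν)) (interval a b)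
    ≡⟨ sum-swap (λ k c → count k (lower c) *ℚ g k) (interval a b) (below ν) ⟩
  sum (λ c → sum (λ k → count k (lower c) *ℚ g k) (interval a b)) (below ν)
    ≡⟨ sum-cong lower-sum (below ν) ⟩
  sum (λ c → alternant (columns 0 n (Δ G)) (points 1 (entries (lower c)))) (below ν)
    ≡⟨ sum-map (λ u → alternant (columns 0 n (Δ G)) (points 1 u)) (entries ∘ lower) (below ν) ⟨
  sum (λ u → alternant (columns 0 n (Δ G)) (points 1 u)) (map (entries ∘ lower) (below ν))
    ≡⟨ cong (sum (λ u → alternant (columns 0 n (Δ G)) (points 1 u))) (map-below ν) ⟩
  sum (λ u → alternant (columns 0 n (Δ G)) (points 1 u)) (interlacing (entries ν))
    ≡⟨ sum-alternant G n (entries ν) (decreasing ν) ⟩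
  alternant (columns 0 (suc n) G) (points 1 (entries ν)) ∎
  where
  g = λ k → Δ^ n (Δ G) (+ 1 ℤ.- k)

  lower-sum : ∀ c → sum (λ k → count k (lower c) *ℚ g k) (interval a b) ≡
                    alternant (columns 0 n (Δ G)) (points 1 (entries (lower c)))
  lower-sum (μ because μ≺ν) = sum-count n (Δ G) μ
    (ℤ.≤-trans a≤ (proj₂ (btw (fromℕ n)))) (ℤ.≤-trans (proj₁ (btw zero)) ≤b)
    where
    btw = recompute (μ ≺? ν) μ≺ν

-- Leading coefficients

-- f is a polynomial function of degree at most i, in which y^i has the
-- coefficient c; divided differences lower i by one and preserve c.
HasLeading : ℕ → ℚ → (ℤ → ℚ) → Set
HasLeading zero    c f = ∀ y → f y ≡ c
HasLeading (suc i) c f =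
  ∀ x → ∃ λ g → HasLeading i c g × (∀ y → f y -ℚ f x ≡ (ι y -ℚ ι x) *ℚ g y)

hasLeading-+ : ∀ {i c f} → HasLeading (suc i) c f → ∀ d → HasLeading (suc i) c (λ y → f y +ℚ d)
hasLeading-+ {f = f} L d x with L x
... | g , Lg , eq = g , Lg , λ y → trans (cancel (f y) (f x) d) (eq y)
  where
  cancel : ∀ a b d → (a +ℚ d) -ℚ (b +ℚ d) ≡ a -ℚ b
  cancel = solve-∀ ℚ-ring

hasLeading-* : ∀ {i c f} → HasLeading i c f → ∀ a d →
               HasLeading (suc i) (c *ℚ a) (λ y → f y *ℚ (a *ℚ (ι y -ℚ d)))
hasLeading-* {zero} {c} {f} f≡c a d x = (λ _ → c *ℚ a) , (λ _ → refl) , λ y →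
  trans (cong₂ (λ u v → u *ℚ (a *ℚ (ι y -ℚ d)) -ℚ v *ℚ (a *ℚ (ι x -ℚ d))) (f≡c y) (f≡c x))
        (factor c a (ι y) (ι x) d)
  where
  factor : ∀ c a y x d → c *ℚ (a *ℚ (y -ℚ d)) -ℚ c *ℚ (a *ℚ (x -ℚ d)) ≡ (y -ℚ x) *ℚ (c *ℚ a)
  factor = solve-∀ ℚ-ring
hasLeading-* {suc i} {c} {f} L a d x with L x
... | g , Lg , eq =
  -- The Leibniz rule for divided differences. The second summand is constant in `y`, and the first
  -- has positive formal degree i + 1, so the leading coefficient comes from the first alone.
  (λ y → g y *ℚ (a *ℚ (ι y -ℚ d)) +ℚ a *ℚ f x) ,
  lower-degree i g Lg ,
  λ y → trans (leibniz (f y) (f x) a (ι y) (ι x) d)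
          (trans (cong (λ e → e *ℚ (a *ℚ (ι y -ℚ d)) +ℚ f x *ℚ (a *ℚ (ι y -ℚ ι x))) (eq y))
            (factor (ι y) (ι x) (g y) a d (f x)))
  where
  lower-degree : ∀ i g → HasLeading i c g →
                 HasLeading (suc i) (c *ℚ a) (λ y → g y *ℚ (a *ℚ (ι y -ℚ d)) +ℚ a *ℚ f x)
  lower-degree i g Lg =
    hasLeading-+ {i} {f = λ y → g y *ℚ (a *ℚ (ι y -ℚ d))} (hasLeading-* {i} {f = g} Lg a d) (a *ℚ f x)

  leibniz : ∀ u v a y x d → u *ℚ (a *ℚ (y -ℚ d)) -ℚ v *ℚ (a *ℚ (x -ℚ d)) ≡
                            (u -ℚ v) *ℚ (a *ℚ (y -ℚ d)) +ℚ v *ℚ (a *ℚ (y -ℚ x))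
  leibniz = solve-∀ ℚ-ring

  factor : ∀ y x g a d v → (y -ℚ x) *ℚ g *ℚ (a *ℚ (y -ℚ d)) +ℚ v *ℚ (a *ℚ (y -ℚ x)) ≡
                           (y -ℚ x) *ℚ (g *ℚ (a *ℚ (y -ℚ d)) +ℚ a *ℚ v)
  factor = solve-∀ ℚ-ring

inverseFactorial : ℕ → ℚ
inverseFactorial zero    = 1ℚ
inverseFactorial (suc a) = inverseFactorial a *ℚ recip a

binom-leading : ∀ a → HasLeading a (inverseFactorial a) (binom a)
binom-leading zero    y = refl
binom-leading (suc a)   = hasLeading-* {a} {f = binom a} (binom-leading a) (recip a) (ι (+ a))

-- Vandermonde products and normalising constants

vandermonde : List ℤ → ℚ
vandermonde []       = 1ℚ
vandermonde (x ∷ xs) = product (λ y → ι y -ℚ ι x) xs *ℚ vandermonde xs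

sign : ℕ → ℚ
sign zero    = 1ℚ
sign (suc n) = ℚ.- sign n

sign-*-sign : ∀ n → sign n *ℚ sign n ≡ 1ℚ
sign-*-sign zero    = refl
sign-*-sign (suc n) = trans (square (sign n)) (sign-*-sign n)
  where
  square : ∀ s → (ℚ.- s) *ℚ (ℚ.- s) ≡ s *ℚ s
  square = solve-∀ ℚ-ring

-- This is 1/(a! (a + 1)! ⋯ (a + n - 1)!). For a = 0 it is the reciprocal of the product of all j -
-- i with 1 ≤ i < j ≤ n, the denominator in Weyl's dimension.
leadingProduct : ℕ → ℕ → ℚ
leadingProduct a zero    = 1ℚ
leadingProduct a (suc n) = inverseFactorial a *ℚ leadingProduct (suc a) n

leadingProduct-suc : ∀ a n → leadingProduct a (suc n) ≡ leadingProduct a n *ℚ inverseFactorial (a ℕ.+ n)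
leadingProduct-suc a zero = begin
  inverseFactorial a *ℚ 1ℚ           ≡⟨ ℚ.*-comm (inverseFactorial a) 1ℚ ⟩
  1ℚ *ℚ inverseFactorial a           ≡⟨ cong (λ e → 1ℚ *ℚ inverseFactorial e) (ℕ.+-identityʳ a) ⟨
  1ℚ *ℚ inverseFactorial (a ℕ.+ 0)   ∎
leadingProduct-suc a (suc n) = begin
  inverseFactorial a *ℚ leadingProduct (suc a) (suc n)
    ≡⟨ cong (inverseFactorial a *ℚ_) (leadingProduct-suc (suc a) n) ⟩
  inverseFactorial a *ℚ (leadingProduct (suc a) n *ℚ inverseFactorial (suc a ℕ.+ n))
    ≡⟨ ℚ.*-assoc (inverseFactorial a) _ _ ⟨
  leadingProduct a (suc n) *ℚ inverseFactorial (suc a ℕ.+ n)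
    ≡⟨ cong (λ e → leadingProduct a (suc n) *ℚ inverseFactorial e) (ℕ.+-suc a n) ⟨
  leadingProduct a (suc n) *ℚ inverseFactorial (a ℕ.+ suc n) ∎

-- Weyl's dimension

∏ℚ-cong : ∀ {n} {f g : Fin n → ℚ} → (∀ i → f i ≡ g i) → ∏ℚ f ≡ ∏ℚ g
∏ℚ-cong {zero}  f≡g = refl
∏ℚ-cong {suc n} f≡g = cong₂ _*ℚ_ (f≡g zero) (∏ℚ-cong (f≡g ∘ suc))

∏ℚ-* : ∀ {n} (f g : Fin n → ℚ) → ∏ℚ (λ i → f i *ℚ g i) ≡ ∏ℚ f *ℚ ∏ℚ g
∏ℚ-* {zero}  f g = refl
∏ℚ-* {suc n} f g = trans (cong (f zero *ℚ g zero *ℚ_) (∏ℚ-* (f ∘ suc) (g ∘ suc)))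
                         (*-interchange (f zero) (g zero) (∏ℚ (f ∘ suc)) (∏ℚ (g ∘ suc)))

∏ℚ-points : ∀ (f : ℤ → ℚ) {n} o (v : Vec ℤ n) →
            ∏ℚ (λ j → f (+ (o ℕ.+ toℕ j) ℤ.- lookup v j)) ≡ product f (points o v)
∏ℚ-points f o []      = refl
∏ℚ-points f o (x ∷ v) = cong₂ _*ℚ_ (cong (λ e → f (+ e ℤ.- x)) (ℕ.+-identityʳ o))
  (trans (∏ℚ-cong (λ j → cong (λ e → f (+ e ℤ.- lookup v j)) (ℕ.+-suc o (toℕ j))))
         (∏ℚ-points f (suc o) v))

∏ℚ-recip : ∀ m n → ∏ℚ {n} (λ j → recip (m ℕ.+ toℕ j)) *ℚ inverseFactorial m ≡ inverseFactorial (m ℕ.+ n)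
∏ℚ-recip m zero    = trans (ℚ.*-identityˡ _) (cong inverseFactorial (sym (ℕ.+-identityʳ m)))
∏ℚ-recip m (suc n) = begin
  recip (m ℕ.+ 0) *ℚ ∏ℚ {n} (λ j → recip (m ℕ.+ suc (toℕ j))) *ℚ inverseFactorial m
    ≡⟨ cong₂ (λ a b → recip a *ℚ b *ℚ inverseFactorial m) (ℕ.+-identityʳ m)
         (∏ℚ-cong {n} (λ j → cong recip (ℕ.+-suc m (toℕ j)))) ⟩
  recip m *ℚ ∏ℚ {n} (λ j → recip (suc m ℕ.+ toℕ j)) *ℚ inverseFactorial m
    ≡⟨ rotate (recip m) (∏ℚ {n} (λ j → recip (suc m ℕ.+ toℕ j))) (inverseFactorial m) ⟩
  ∏ℚ {n} (λ j → recip (suc m ℕ.+ toℕ j)) *ℚ inverseFactorial (suc m)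
    ≡⟨ ∏ℚ-recip (suc m) n ⟩
  inverseFactorial (suc m ℕ.+ n)
    ≡⟨ cong inverseFactorial (ℕ.+-suc m n) ⟨
  inverseFactorial (m ℕ.+ suc n) ∎
  where
  rotate : ∀ a b c → a *ℚ b *ℚ c ≡ b *ℚ (c *ℚ a)
  rotate = solve-∀ ℚ-ring

-- The offset is free because only differences of points occur, and the tail of the signature has
-- points starting at `suc o`. Peeling off the first entry takes one factor from each later
-- position: the numerators form the first factor of the Vandermonde product, and the denominators
-- 1, ..., n give 1/n!.
Dim-vandermonde : ∀ {n} o (ν : Sig n) →
                  Dim ν ≡ leadingProduct 0 n *ℚ vandermonde (points o (entries ν))
Dim-vandermonde         o (sig []      _)   = refl
Dim-vandermonde {suc n} o ν@(sig (x ∷ v) dec) = begin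
  1ℚ *ℚ ∏ℚ (λ j → weylFactor ν (suc j) zero *ℚ ∏ℚ (λ i → weylFactor ν (suc j) (suc i)))
    ≡⟨ ℚ.*-identityˡ _ ⟩
  ∏ℚ (λ j → weylFactor ν (suc j) zero *ℚ ∏ℚ (λ i → weylFactor ν (suc j) (suc i)))
    ≡⟨ ∏ℚ-cong (λ j → cong₂ _*ℚ_ (first-factor j) (∏ℚ-cong (other-factor j))) ⟩
  ∏ℚ (λ j → w (+ (suc o ℕ.+ toℕ j) ℤ.- lookup v j) *ℚ recip (toℕ j) *ℚ ∏ℚ (weylFactor μ j))
    ≡⟨ trans (∏ℚ-* (λ j → w (+ (suc o ℕ.+ toℕ j) ℤ.- lookup v j) *ℚ recip (toℕ j)) (λ j → ∏ℚ (weylFactor μ j)))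
             (cong (_*ℚ Dim μ) (∏ℚ-* (λ j → w (+ (suc o ℕ.+ toℕ j) ℤ.- lookup v j)) (λ j → recip (toℕ j)))) ⟩
  ∏ℚ (λ j → w (+ (suc o ℕ.+ toℕ j) ℤ.- lookup v j)) *ℚ ∏ℚ {n} (λ j → recip (toℕ j)) *ℚ Dim μ
    ≡⟨ cong₂ (λ a b → a *ℚ b *ℚ Dim μ) (∏ℚ-points w (suc o) v)
         (trans (sym (ℚ.*-identityʳ _)) (∏ℚ-recip 0 n)) ⟩
  product w (points (suc o) v) *ℚ inverseFactorial n *ℚ Dim μ
    ≡⟨ cong (product w (points (suc o) v) *ℚ inverseFactorial n *ℚ_) (Dim-vandermonde (suc o) μ) ⟩
  product w (points (suc o) v) *ℚ inverseFactorial n *ℚ (leadingProduct 0 n *ℚ vandermonde (points (suc o) v))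
    ≡⟨ rearrange (product w (points (suc o) v)) (inverseFactorial n) (leadingProduct 0 n) _ ⟩
  leadingProduct 0 n *ℚ inverseFactorial n *ℚ (product w (points (suc o) v) *ℚ vandermonde (points (suc o) v))
    ≡⟨ cong (_*ℚ vandermonde (points o (x ∷ v))) (leadingProduct-suc 0 n) ⟨
  leadingProduct 0 (suc n) *ℚ vandermonde (points o (x ∷ v)) ∎
  where
  μ = sig v (Linked.tail dec)
  w = λ y → ι y -ℚ ι (+ o ℤ.- x)

  first-factor : ∀ j → weylFactor ν (suc j) zero ≡ w (+ (suc o ℕ.+ toℕ j) ℤ.- lookup v j) *ℚ recip (toℕ j)
  first-factor j = trans (/-≡-* (x ℤ.- lookup v j ℤ.- + 1 ℤ.+ (+ suc (suc (toℕ j)))) (suc (toℕ j)))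
    (cong (_*ℚ recip (toℕ j))
      (trans (cong ι (numerator x (lookup v j) (+ toℕ j) (+ o))) (ι-‿- (+ (suc o ℕ.+ toℕ j) ℤ.- lookup v j) (+ o ℤ.- x))))
    where
    numerator : ∀ x y j o → x ℤ.- y ℤ.- + 1 ℤ.+ (+ 2 ℤ.+ j) ≡ ((+ 1 ℤ.+ o) ℤ.+ j ℤ.- y) ℤ.- (o ℤ.- x)
    numerator = solve-∀ ℤ-ring

  other-factor : ∀ j i → weylFactor ν (suc j) (suc i) ≡ weylFactor μ j i
  other-factor j i = cong (λ z → (z / (toℕ j ℕ.∸ toℕ (inject i))) {{ℕ.>-nonZero (ℕ.m<n⇒0<n∸m (inject-< j i))}})
    (numerator (lookup v (inject i)) (lookup v j) (pos (inject i)) (pos j))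
    where
    numerator : ∀ x y i j → x ℤ.- y ℤ.- (+ 1 ℤ.+ i) ℤ.+ (+ 1 ℤ.+ j) ≡ x ℤ.- y ℤ.- i ℤ.+ j
    numerator = solve-∀ ℤ-ring

  rearrange : ∀ a b c d → a *ℚ b *ℚ (c *ℚ d) ≡ c *ℚ b *ℚ (a *ℚ d)
  rearrange = solve-∀ ℚ-ring

length-columns : ∀ a n G → List.length (columns a n G) ≡ suc n
length-columns a zero    G = refl
length-columns a (suc n) G = cong suc (length-columns (suc a) n G)

length-points : ∀ {n} o (v : Vec ℤ n) → List.length (points o v) ≡ n
length-points o []      = refl
length-points o (x ∷ v) = cong suc (length-points (suc o) v)

-- A Cauchy kernel

-- Here `t` is a rational number and `φ y` is 1/(t + y); `φ-inverse` expresses that t + y is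
-- invertible for every integer y, as happens at half-integers.
module Cauchy (t : ℚ) (φ : ℤ → ℚ) (φ-inverse : ∀ y → (t +ℚ ι y) *ℚ φ y ≡ 1ℚ) where

  -- The divided difference of `φ` at `x` is `φ` itself times the constant `ℚ.- φ x`. This closes
  -- `System` under `divide`.
  φ-divided : ∀ x y → φ y -ℚ φ x ≡ (ι y -ℚ ι x) *ℚ ((ℚ.- φ x) *ℚ φ y)
  φ-divided x y = begin
    φ y -ℚ φ x
      ≡⟨ cong₂ _-ℚ_ (sym (ℚ.*-identityˡ (φ y))) (sym (ℚ.*-identityˡ (φ x))) ⟩
    1ℚ *ℚ φ y -ℚ 1ℚ *ℚ φ x
      ≡⟨ cong₂ (λ a b → a *ℚ φ y -ℚ b *ℚ φ x) (φ-inverse x) (φ-inverse y) ⟨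
    (t +ℚ ι x) *ℚ φ x *ℚ φ y -ℚ (t +ℚ ι y) *ℚ φ y *ℚ φ x
      ≡⟨ factor t (ι x) (ι y) (φ x) (φ y) ⟩
    (ι y -ℚ ι x) *ℚ ((ℚ.- φ x) *ℚ φ y) ∎
    where
    factor : ∀ t x y p q → (t +ℚ x) *ℚ p *ℚ q -ℚ (t +ℚ y) *ℚ q *ℚ p ≡ (y -ℚ x) *ℚ ((ℚ.- p) *ℚ q)
    factor = solve-∀ ℚ-ring

  -- Polynomials of degrees i, i + 1, … followed by a multiple of φ; the last
  -- index is the product of the leading coefficients.
  data System : ℕ → List (ℤ → ℚ) → ℚ → Set where
    last : ∀ {i f a} → (∀ y → f y ≡ a *ℚ φ y) → System i (f ∷ []) a
    _∷_  : ∀ {i f fs c p} → HasLeading i c f → System (suc i) fs p → System i (f ∷ fs) (c *ℚ p)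

  divide : ∀ {i fs p} → System (suc i) fs p → ∀ x →
           ∃ λ gs → System i gs (p *ℚ (ℚ.- φ x)) ×
                    Pointwise (λ f g → ∀ y → f y -ℚ f x ≡ (ι y -ℚ ι x) *ℚ g y) fs gs
  divide {p = p} (last {f = f} f≡) x =
    (λ y → p *ℚ (ℚ.- φ x) *ℚ φ y) ∷ [] , last (λ _ → refl) , (λ y → begin
      f y -ℚ f x                                       ≡⟨ cong₂ _-ℚ_ (f≡ y) (f≡ x) ⟩
      p *ℚ φ y -ℚ p *ℚ φ x                             ≡⟨ factor p (φ y) (φ x) ⟩
      p *ℚ (φ y -ℚ φ x)                                ≡⟨ cong (p *ℚ_) (φ-divided x y) ⟩
      p *ℚ ((ι y -ℚ ι x) *ℚ ((ℚ.- φ x) *ℚ φ y))        ≡⟨ rearrange p (ι y -ℚ ι x) (ℚ.- φ x) (φ y) ⟩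
      (ι y -ℚ ι x) *ℚ (p *ℚ (ℚ.- φ x) *ℚ φ y)          ∎) ∷ []
    where
    factor : ∀ p a b → p *ℚ a -ℚ p *ℚ b ≡ p *ℚ (a -ℚ b)
    factor = solve-∀ ℚ-ring

    rearrange : ∀ p d a b → p *ℚ (d *ℚ (a *ℚ b)) ≡ d *ℚ (p *ℚ a *ℚ b)
    rearrange = solve-∀ ℚ-ring
  divide {i} (_∷_ {c = c} {p} L S) x with L x | divide S x
  ... | g , Lg , eq | gs , Sg , eqs =
    g ∷ gs , subst (System i (g ∷ gs)) (sym (ℚ.*-assoc c p (ℚ.- φ x))) (Lg ∷ Sg) , eq ∷ eqs

  -- The constant first column is exchanged for differences from `x`. The row of z then has the
  -- factor z - x, and these factors form the first part of the Vandermonde product; the divided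
  -- differences are a system of one degree less at the remaining points. Every point but the last
  -- contributes a factor `ℚ.- φ x`, the last one `φ x`, whence `sign`.
  alternant-System : ∀ {fs p} → System 0 fs p → ∀ x xs → List.length fs ≡ suc (List.length xs) →
    alternant fs (x ∷ xs) ≡
    p *ℚ (vandermonde (x ∷ xs) *ℚ (sign (List.length xs) *ℚ product φ (x ∷ xs)))
  alternant-System {p = p} (last {f = f} f≡) x [] _ =
    trans (cong (λ e → e *ℚ 1ℚ -ℚ 0ℚ) (f≡ x)) (simplify p (φ x))
    where
    simplify : ∀ p q → p *ℚ q *ℚ 1ℚ -ℚ 0ℚ ≡ p *ℚ (1ℚ *ℚ 1ℚ *ℚ (1ℚ *ℚ (q *ℚ 1ℚ)))
    simplify = solve-∀ ℚ-ring
  alternant-System (_ ∷ last _) x [] ()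
  alternant-System (_ ∷ _ ∷ _)  x [] ()
  alternant-System (_∷_ {f = f} {fs} {c} {p} f≡c S) x (y ∷ ys) len with divide S x
  ... | gs , Sg , eqs = begin
    alternant (f ∷ fs) (x ∷ y ∷ ys)
      ≡⟨ alternant-constantᶠ f≡c fs x (y ∷ ys) ⟩
    c *ℚ alternant (map apply fs) (diffs (δ x) (map δ (y ∷ ys)))
      ≡⟨ cong (c *ℚ_) (alternant-diffs-δ fs x (y ∷ ys)) ⟩
    c *ℚ alternant (map (λ f z → f z -ℚ f x) fs) (y ∷ ys)
      ≡⟨ cong (c *ℚ_) (alternant-param _≡_ (Pointwise.map⁺ (λ f z → f z -ℚ f x) (λ g z → w z *ℚ g z) (Pointwise.map (λ { eq refl → eq _ }) eqs)) (Pointwise.refl refl)) ⟩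
    c *ℚ alternant (map (λ g z → w z *ℚ g z) gs) (y ∷ ys)
      ≡⟨ cong (c *ℚ_) (trans (alternant-scale w gs (y ∷ ys)) (cong (product w (y ∷ ys) *ℚ_)
           (alternant-System Sg y ys (trans (sym (Pointwise.Pointwise-length eqs)) (ℕ.suc-injective len))))) ⟩
    c *ℚ (product w (y ∷ ys) *ℚ (p *ℚ (ℚ.- φ x) *ℚ (vandermonde (y ∷ ys) *ℚ (s *ℚ product φ (y ∷ ys)))))
      ≡⟨ rearrange c (product w (y ∷ ys)) p (φ x) (vandermonde (y ∷ ys)) s (product φ (y ∷ ys)) ⟩
    c *ℚ p *ℚ (vandermonde (x ∷ y ∷ ys) *ℚ ((ℚ.- s) *ℚ product φ (x ∷ y ∷ ys))) ∎
    where
    w = λ z → ι z -ℚ ι x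
    s = sign (List.length ys)

    rearrange : ∀ c w p q v s r → c *ℚ (w *ℚ (p *ℚ (ℚ.- q) *ℚ (v *ℚ (s *ℚ r)))) ≡
                                  c *ℚ p *ℚ (w *ℚ v *ℚ ((ℚ.- s) *ℚ (q *ℚ r)))
    rearrange = solve-∀ ℚ-ring

  -- The reciprocal of (t + y)(t + y + 1)⋯(t + y + n), with n + 1 factors. At y = 1 - k this is one
  -- over the denominator of `kernel (suc n) k`.
  ψ : ℕ → ℤ → ℚ
  ψ zero    y = φ y
  ψ (suc n) y = φ y *ℚ ψ n (ℤ.suc y)

  -- Leibniz rule: the difference of the first factor contributes one copy of `ℚ.- ψ (suc n) y`, and
  -- that of the other n factors contributes n copies by induction.
  Δ-ψ : ∀ n y → Δ (ψ n) y ≡ ℚ.- (ι (+ suc n) *ℚ ψ (suc n) y)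
  Δ-ψ zero y = trans (φ-divided y (ℤ.suc y))
    (trans (cong (λ e → (e -ℚ ι y) *ℚ ((ℚ.- φ y) *ℚ φ (ℤ.suc y))) (ι-+ (+ 1) y))
           (simplify (ι y) (φ y) (φ (ℤ.suc y))))
    where
    simplify : ∀ e a b → (1ℚ +ℚ e -ℚ e) *ℚ ((ℚ.- a) *ℚ b) ≡ ℚ.- (1ℚ *ℚ (a *ℚ b))
    simplify = solve-∀ ℚ-ring
  Δ-ψ (suc n) y = begin
    b *ℚ ψ n (ℤ.suc y⁺) -ℚ a *ℚ ψ n y⁺
      ≡⟨ leibniz a b (ψ n y⁺) (ψ n (ℤ.suc y⁺)) ⟩
    (b -ℚ a) *ℚ ψ n (ℤ.suc y⁺) +ℚ a *ℚ Δ (ψ n) y⁺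
      ≡⟨ cong₂ (λ d e → d *ℚ ψ n (ℤ.suc y⁺) +ℚ a *ℚ e) (Δ-ψ zero y) (Δ-ψ n y⁺) ⟩
    ℚ.- (1ℚ *ℚ (a *ℚ b)) *ℚ ψ n (ℤ.suc y⁺) +ℚ a *ℚ (ℚ.- (ι (+ suc n) *ℚ (b *ℚ ψ n (ℤ.suc y⁺))))
      ≡⟨ collect a b (ψ n (ℤ.suc y⁺)) (ι (+ suc n)) ⟩
    ℚ.- ((1ℚ +ℚ ι (+ suc n)) *ℚ ψ (suc (suc n)) y)
      ≡⟨ cong (λ e → ℚ.- (e *ℚ ψ (suc (suc n)) y)) (ι-+ (+ 1) (+ suc n)) ⟨
    ℚ.- (ι (+ suc (suc n)) *ℚ ψ (suc (suc n)) y) ∎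
    where
    y⁺ = ℤ.suc y
    a = φ y
    b = φ y⁺

    leibniz : ∀ a b p q → b *ℚ q -ℚ a *ℚ p ≡ (b -ℚ a) *ℚ q +ℚ a *ℚ (q -ℚ p)
    leibniz = solve-∀ ℚ-ring

    collect : ∀ a b p m → ℚ.- (1ℚ *ℚ (a *ℚ b)) *ℚ p +ℚ a *ℚ (ℚ.- (m *ℚ (b *ℚ p))) ≡
                          ℚ.- ((1ℚ +ℚ m) *ℚ (a *ℚ (b *ℚ p)))
    collect = solve-∀ ℚ-ring

  -- `Δ^` recurses on the innermost difference, to match the induction of `sum-count`; iterating
  -- `Δ-ψ` needs the outermost one.
  Δ^-suc : ∀ n G y → Δ^ (suc n) G y ≡ Δ (Δ^ n G) y
  Δ^-suc zero    G y = refl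
  Δ^-suc (suc n) G y = Δ^-suc n (Δ G) y

  inverseFactorial-Δ^ : ∀ n y → inverseFactorial n *ℚ Δ^ n φ y ≡ sign n *ℚ ψ n y
  inverseFactorial-Δ^ zero    y = refl
  inverseFactorial-Δ^ (suc n) y = begin
    c *ℚ r *ℚ Δ^ (suc n) φ y
      ≡⟨ cong (c *ℚ r *ℚ_) (Δ^-suc n φ y) ⟩
    c *ℚ r *ℚ (Δ^ n φ (ℤ.suc y) -ℚ Δ^ n φ y)
      ≡⟨ distrib c r (Δ^ n φ (ℤ.suc y)) (Δ^ n φ y) ⟩
    r *ℚ (c *ℚ Δ^ n φ (ℤ.suc y) -ℚ c *ℚ Δ^ n φ y)
      ≡⟨ cong₂ (λ a b → r *ℚ (a -ℚ b)) (inverseFactorial-Δ^ n (ℤ.suc y)) (inverseFactorial-Δ^ n y) ⟩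
    r *ℚ (sign n *ℚ ψ n (ℤ.suc y) -ℚ sign n *ℚ ψ n y)
      ≡⟨ factor r (sign n) (ψ n (ℤ.suc y)) (ψ n y) ⟩
    r *ℚ sign n *ℚ Δ (ψ n) y
      ≡⟨ cong (r *ℚ sign n *ℚ_) (Δ-ψ n y) ⟩
    r *ℚ sign n *ℚ (ℚ.- (ι (+ suc n) *ℚ ψ (suc n) y))
      ≡⟨ regroup r (sign n) (ι (+ suc n)) (ψ (suc n) y) ⟩
    ι (+ suc n) *ℚ r *ℚ ((ℚ.- sign n) *ℚ ψ (suc n) y)
      ≡⟨ trans (cong (_*ℚ ((ℚ.- sign n) *ℚ ψ (suc n) y)) (recip-inverse n)) (ℚ.*-identityˡ _) ⟩
    sign (suc n) *ℚ ψ (suc n) y ∎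
    where
    c = inverseFactorial n
    r = recip n

    distrib : ∀ c r a b → c *ℚ r *ℚ (a -ℚ b) ≡ r *ℚ (c *ℚ a -ℚ c *ℚ b)
    distrib = solve-∀ ℚ-ring

    factor : ∀ r s a b → r *ℚ (s *ℚ a -ℚ s *ℚ b) ≡ r *ℚ s *ℚ (a -ℚ b)
    factor = solve-∀ ℚ-ring

    regroup : ∀ r s m p → r *ℚ s *ℚ (ℚ.- (m *ℚ p)) ≡ m *ℚ r *ℚ ((ℚ.- s) *ℚ p)
    regroup = solve-∀ ℚ-ring

  columns-System : ∀ a n → System a (columns a n φ) (leadingProduct a n)
  columns-System a zero    = last (λ y → sym (ℚ.*-identityˡ (φ y)))
  columns-System a (suc n) = binom-leading a ∷ columns-System (suc a) n

  alternant-points : ∀ {n} (v : Vec ℤ (suc n)) → alternant (columns 0 n φ) (points 1 v) ≡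
    leadingProduct 0 n *ℚ (vandermonde (points 1 v) *ℚ (sign n *ℚ product φ (points 1 v)))
  alternant-points {n} (x ∷ v) =
    subst (λ m → alternant (columns 0 n φ) (points 1 (x ∷ v)) ≡
                 leadingProduct 0 n *ℚ (vandermonde (points 1 (x ∷ v)) *ℚ (sign m *ℚ product φ (points 1 (x ∷ v)))))
      (length-points 2 v)
      (alternant-System (columns-System 0 n) (+ 1 ℤ.- x) (points 2 v)
        (trans (length-columns 0 n φ) (cong suc (sym (length-points 2 v)))))

  -- The sign of the n-th difference cancels that of the determinant. The 1/n! that normalises the
  -- difference is the factor by which `leadingProduct 0 n`, from the n binomial columns, falls
  -- short of the constant in `Dim` for n + 1 entries.
  sum-count-ψ : ∀ {n} (ν : Sig (suc n)) →
    sum (λ k → count k ν *ℚ ψ n (+ 1 ℤ.- k)) (interval (ν ! fromℕ n) (ν ! zero)) ≡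
    Dim ν *ℚ product φ (points 1 (entries ν))
  sum-count-ψ {n} ν = begin
    sum (λ k → count k ν *ℚ ψ n (+ 1 ℤ.- k)) ks
      ≡⟨ sum-cong normalise ks ⟩
    sum (λ k → s *ℚ c *ℚ (count k ν *ℚ Δ^ n φ (+ 1 ℤ.- k))) ks
      ≡⟨ sum-*ˡ (s *ℚ c) (λ k → count k ν *ℚ Δ^ n φ (+ 1 ℤ.- k)) ks ⟩
    s *ℚ c *ℚ sum (λ k → count k ν *ℚ Δ^ n φ (+ 1 ℤ.- k)) ks
      ≡⟨ cong (s *ℚ c *ℚ_) (trans (sum-count n φ ν ℤ.≤-refl ℤ.≤-refl) (alternant-points (entries ν))) ⟩
    s *ℚ c *ℚ (leadingProduct 0 n *ℚ (V *ℚ (s *ℚ P)))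
      ≡⟨ rearrange s c (leadingProduct 0 n) V P ⟩
    s *ℚ s *ℚ (leadingProduct 0 n *ℚ c *ℚ V *ℚ P)
      ≡⟨ cong₂ _*ℚ_ (sign-*-sign n) (cong (λ e → e *ℚ V *ℚ P) (sym (leadingProduct-suc 0 n))) ⟩
    1ℚ *ℚ (leadingProduct 0 (suc n) *ℚ V *ℚ P)
      ≡⟨ ℚ.*-identityˡ _ ⟩
    leadingProduct 0 (suc n) *ℚ V *ℚ P
      ≡⟨ cong (_*ℚ P) (Dim-vandermonde 1 ν) ⟨
    Dim ν *ℚ P ∎
    where
    ks = interval (ν ! fromℕ n) (ν ! zero)
    s = sign n
    c = inverseFactorial n
    V = vandermonde (points 1 (entries ν))
    P = product φ (points 1 (entries ν))

    rearrange : ∀ s c l v p → s *ℚ c *ℚ (l *ℚ (v *ℚ (s *ℚ p))) ≡ s *ℚ s *ℚ (l *ℚ c *ℚ v *ℚ p)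
    rearrange = solve-∀ ℚ-ring

    regroup : ∀ s c a b → a *ℚ (s *ℚ (c *ℚ b)) ≡ s *ℚ c *ℚ (a *ℚ b)
    regroup = solve-∀ ℚ-ring

    normalise : ∀ k → count k ν *ℚ ψ n (+ 1 ℤ.- k) ≡ s *ℚ c *ℚ (count k ν *ℚ Δ^ n φ (+ 1 ℤ.- k))
    normalise k = begin
      count k ν *ℚ ψ n y                   ≡⟨ cong (count k ν *ℚ_) (ℚ.*-identityˡ (ψ n y)) ⟨
      count k ν *ℚ (1ℚ *ℚ ψ n y)           ≡⟨ cong (λ e → count k ν *ℚ (e *ℚ ψ n y)) (sign-*-sign n) ⟨
      count k ν *ℚ (s *ℚ s *ℚ ψ n y)       ≡⟨ cong (count k ν *ℚ_) (ℚ.*-assoc s s (ψ n y)) ⟩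
      count k ν *ℚ (s *ℚ (s *ℚ ψ n y))     ≡⟨ cong (λ e → count k ν *ℚ (s *ℚ e)) (inverseFactorial-Δ^ n y) ⟨
      count k ν *ℚ (s *ℚ (c *ℚ Δ^ n φ y))  ≡⟨ regroup s c (count k ν) (Δ^ n φ y) ⟩
      s *ℚ c *ℚ (count k ν *ℚ Δ^ n φ y)    ∎
      where
      y = + 1 ℤ.- k

  ψ-∏ℚ : ∀ n y → ψ n y ≡ ∏ℚ {suc n} (λ j → φ (+ toℕ j ℤ.+ y))
  ψ-∏ℚ zero    y = trans (cong φ (sym (ℤ.+-identityˡ y))) (sym (ℚ.*-identityʳ _))
  ψ-∏ℚ (suc n) y = cong₂ _*ℚ_ (cong φ (sym (ℤ.+-identityˡ y)))
    (trans (ψ-∏ℚ n (ℤ.suc y)) (∏ℚ-cong {suc n} (λ j → cong φ (shift (+ toℕ j) y))))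
    where
    shift : ∀ j y → j ℤ.+ (+ 1 ℤ.+ y) ≡ (+ 1 ℤ.+ j) ℤ.+ y
    shift = solve-∀ ℤ-ring

  ∏ℚ-pos : ∀ n k → ∏ℚ {suc n} (λ j → φ (pos j ℤ.- k)) ≡ ψ n (+ 1 ℤ.- k)
  ∏ℚ-pos n k = trans (∏ℚ-cong {suc n} (λ j → cong φ (shift (+ toℕ j) k))) (sym (ψ-∏ℚ n (+ 1 ℤ.- k)))
    where
    shift : ∀ j k → (+ 1 ℤ.+ j) ℤ.- k ≡ j ℤ.+ (+ 1 ℤ.- k)
    shift = solve-∀ ℤ-ring

  sum-F : ∀ {n} (ν : Sig (suc n)) →
    sum (λ k → F k ν *ℚ ∏ℚ {suc n} (λ j → φ (pos j ℤ.- k))) (interval (ν ! fromℕ n) (ν ! zero)) ≡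
    ∏ℚ (λ j → φ (pos j ℤ.- ν ! j))
  sum-F {n} ν = begin
    sum (λ k → count k ν *ℚ d⁻¹ *ℚ ∏ℚ {suc n} (λ j → φ (pos j ℤ.- k))) ks
      ≡⟨ sum-cong (λ k → trans (cong (count k ν *ℚ d⁻¹ *ℚ_) (∏ℚ-pos n k)) (rotate (count k ν) d⁻¹ (ψ n (+ 1 ℤ.- k)))) ks ⟩
    sum (λ k → d⁻¹ *ℚ (count k ν *ℚ ψ n (+ 1 ℤ.- k))) ks
      ≡⟨ trans (sum-*ˡ d⁻¹ (λ k → count k ν *ℚ ψ n (+ 1 ℤ.- k)) ks) (cong (d⁻¹ *ℚ_) (sum-count-ψ ν)) ⟩
    d⁻¹ *ℚ (Dim ν *ℚ P)
      ≡⟨ ℚ.*-assoc d⁻¹ (Dim ν) P ⟨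
    d⁻¹ *ℚ Dim ν *ℚ P
      ≡⟨ trans (cong (_*ℚ P) (ℚ.*-inverseˡ (Dim ν) {{Dim-nonZero ν}})) (ℚ.*-identityˡ P) ⟩
    P
      ≡⟨ ∏ℚ-points φ 1 (entries ν) ⟨
    ∏ℚ (λ j → φ (pos j ℤ.- ν ! j)) ∎
    where
    ks = interval (ν ! fromℕ n) (ν ! zero)
    d⁻¹ = (ℚ.1/ Dim ν) {{Dim-nonZero ν}}
    P = product φ (points 1 (entries ν))

    rotate : ∀ a b c → a *ℚ b *ℚ c ≡ b *ℚ (a *ℚ c)
    rotate = solve-∀ ℚ-ring

-- Polynomials and rational functions by evaluation

eval : Poly → ℚ → ℚ
eval []      t = 0ℚ
eval (a ∷ p) t = a +ℚ t *ℚ eval p t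

eval-+ₚ : ∀ p q t → eval (p +ₚ q) t ≡ eval p t +ℚ eval q t
eval-+ₚ []      q       t = sym (ℚ.+-identityˡ (eval q t))
eval-+ₚ (a ∷ p) []      t = sym (ℚ.+-identityʳ (eval (a ∷ p) t))
eval-+ₚ (a ∷ p) (b ∷ q) t =
  trans (cong (λ e → (a +ℚ b) +ℚ t *ℚ e) (eval-+ₚ p q t)) (rearrange a b t (eval p t) (eval q t))
  where
  rearrange : ∀ a b t p q → (a +ℚ b) +ℚ t *ℚ (p +ℚ q) ≡ (a +ℚ t *ℚ p) +ℚ (b +ℚ t *ℚ q)
  rearrange = solve-∀ ℚ-ring

eval-·ₚ : ∀ a p t → eval (a ·ₚ p) t ≡ a *ℚ eval p t
eval-·ₚ a []      t = sym (ℚ.*-zeroʳ a)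
eval-·ₚ a (b ∷ p) t = trans (cong (λ e → a *ℚ b +ℚ t *ℚ e) (eval-·ₚ a p t)) (factor a b t (eval p t))
  where
  factor : ∀ a b t p → a *ℚ b +ℚ t *ℚ (a *ℚ p) ≡ a *ℚ (b +ℚ t *ℚ p)
  factor = solve-∀ ℚ-ring

eval-*ₚ : ∀ p q t → eval (p *ₚ q) t ≡ eval p t *ℚ eval q t
eval-*ₚ []      q t = sym (ℚ.*-zeroˡ (eval q t))
eval-*ₚ (a ∷ p) q t = begin
  eval (a ·ₚ q +ₚ (0ℚ ∷ p *ₚ q)) t
    ≡⟨ eval-+ₚ (a ·ₚ q) (0ℚ ∷ p *ₚ q) t ⟩
  eval (a ·ₚ q) t +ℚ (0ℚ +ℚ t *ℚ eval (p *ₚ q) t)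
    ≡⟨ cong₂ (λ d e → d +ℚ (0ℚ +ℚ t *ℚ e)) (eval-·ₚ a q t) (eval-*ₚ p q t) ⟩
  a *ℚ eval q t +ℚ (0ℚ +ℚ t *ℚ (eval p t *ℚ eval q t))
    ≡⟨ factor a t (eval p t) (eval q t) ⟩
  (a +ℚ t *ℚ eval p t) *ℚ eval q t ∎
  where
  factor : ∀ a t p q → a *ℚ q +ℚ (0ℚ +ℚ t *ℚ (p *ℚ q)) ≡ (a +ℚ t *ℚ p) *ℚ q
  factor = solve-∀ ℚ-ring

eval-t+ : ∀ a t → eval (t+ a) t ≡ t +ℚ ι a
eval-t+ a t = simplify (ι a) t
  where
  simplify : ∀ a t → a +ℚ t *ℚ (1ℚ +ℚ t *ℚ 0ℚ) ≡ t +ℚ a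
  simplify = solve-∀ ℚ-ring

eval-∏ₚ : ∀ {n} (p : Fin n → Poly) t → eval (∏ₚ p) t ≡ ∏ℚ (λ i → eval (p i) t)
eval-∏ₚ {zero}  p t = simplify t
  where
  simplify : ∀ t → 1ℚ +ℚ t *ℚ 0ℚ ≡ 1ℚ
  simplify = solve-∀ ℚ-ring
eval-∏ₚ {suc n} p t = trans (eval-*ₚ (p zero) (∏ₚ (p ∘ suc)) t) (cong (eval (p zero) t *ℚ_) (eval-∏ₚ (p ∘ suc) t))

-- The quotient of p by t - c in Horner's scheme: its coefficients are the
-- values at c of the proper suffixes of p.
quotient : Poly → ℚ → Poly
quotient []            c = []
quotient (a ∷ [])      c = []
quotient (a ∷ p@(_ ∷ _)) c = eval p c ∷ quotient p c

eval-quotient : ∀ p c t → eval p t ≡ eval p c +ℚ (t -ℚ c) *ℚ eval (quotient p c) t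
eval-quotient []              c t = simplify t c
  where
  simplify : ∀ t c → 0ℚ ≡ 0ℚ +ℚ (t -ℚ c) *ℚ 0ℚ
  simplify = solve-∀ ℚ-ring
eval-quotient (a ∷ [])        c t = simplify a t c
  where
  simplify : ∀ a t c → a +ℚ t *ℚ 0ℚ ≡ a +ℚ c *ℚ 0ℚ +ℚ (t -ℚ c) *ℚ 0ℚ
  simplify = solve-∀ ℚ-ring
eval-quotient (a ∷ p@(_ ∷ _)) c t =
  trans (cong (λ e → a +ℚ t *ℚ e) (eval-quotient p c t)) (rearrange a t c (eval p c) (eval (quotient p c) t))
  where
  rearrange : ∀ a t c p q → a +ℚ t *ℚ (p +ℚ (t -ℚ c) *ℚ q) ≡ a +ℚ c *ℚ p +ℚ (t -ℚ c) *ℚ (p +ℚ t *ℚ q)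
  rearrange = solve-∀ ℚ-ring

length-quotient : ∀ a p c → List.length (quotient (a ∷ p) c) ≡ List.length p
length-quotient a []      c = refl
length-quotient a (b ∷ p) c = cong suc (length-quotient b p c)

-- The first coefficient of the quotient is the value at `c` of the tail of `p`. Its vanishing and
-- p(c) = 0 kill the head of `p` and make `c` a root of the tail.
quotient-0 : ∀ p c → eval p c ≡ 0ℚ → quotient p c ≈ₚ 0ₚ → p ≈ₚ 0ₚ
quotient-0 []              c p≡0 q≈0 n       = refl
quotient-0 (a ∷ [])        c p≡0 q≈0 zero    = trans (simplify a c) p≡0
  where
  simplify : ∀ a c → a ≡ a +ℚ c *ℚ 0ℚ
  simplify = solve-∀ ℚ-ring
quotient-0 (a ∷ [])        c p≡0 q≈0 (suc n) = refl
quotient-0 (a ∷ p@(_ ∷ _)) c p≡0 q≈0 zero    =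
  trans (cancel a (c *ℚ eval p c)) (cong₂ _-ℚ_ p≡0 (trans (cong (c *ℚ_) (q≈0 0)) (ℚ.*-zeroʳ c)))
  where
  cancel : ∀ a b → a ≡ (a +ℚ b) -ℚ b
  cancel = solve-∀ ℚ-ring
quotient-0 (a ∷ p@(_ ∷ _)) c p≡0 q≈0 (suc n) = quotient-0 p c (q≈0 0) (q≈0 ∘ suc) n

-- Root counting by induction on the number of listed coefficients: division by the linear factor at
-- `t 0` shortens the list by one, and the later nodes remain roots because they differ from `t 0`.
vanishing⇒≈0 : ∀ n p → List.length p ≡ n → (t : ℕ → ℚ) → (∀ {i j} → t i ≡ t j → i ≡ j) →
               (∀ i → eval p (t i) ≡ 0ℚ) → p ≈ₚ 0ₚ
vanishing⇒≈0 zero    []      _   t inj p≡0 _ = refl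
vanishing⇒≈0 (suc n) (a ∷ p) len t inj p≡0 = quotient-0 (a ∷ p) (t 0) (p≡0 0)
  (vanishing⇒≈0 n q (trans (length-quotient a p (t 0)) (ℕ.suc-injective len)) (t ∘ suc)
    (ℕ.suc-injective ∘ inj) λ i → *-cancel-0 (distinct i) (root i))
  where
  q = quotient (a ∷ p) (t 0)

  restore : ∀ a b → a ≡ (a -ℚ b) +ℚ b
  restore = solve-∀ ℚ-ring

  distinct : ∀ i → t (suc i) -ℚ t 0 ≢ 0ℚ
  distinct i eq with () ← inj (trans (restore (t (suc i)) (t 0)) (trans (cong (_+ℚ t 0) eq) (ℚ.+-identityˡ (t 0))))

  root : ∀ i → (t (suc i) -ℚ t 0) *ℚ eval q (t (suc i)) ≡ 0ℚ
  root i = begin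
    (t (suc i) -ℚ t 0) *ℚ eval q (t (suc i))
      ≡⟨ ℚ.+-identityˡ _ ⟨
    0ℚ +ℚ (t (suc i) -ℚ t 0) *ℚ eval q (t (suc i))
      ≡⟨ cong (_+ℚ (t (suc i) -ℚ t 0) *ℚ eval q (t (suc i))) (p≡0 0) ⟨
    eval (a ∷ p) (t 0) +ℚ (t (suc i) -ℚ t 0) *ℚ eval q (t (suc i))
      ≡⟨ eval-quotient (a ∷ p) (t 0) (t (suc i)) ⟨
    eval (a ∷ p) (t (suc i))
      ≡⟨ p≡0 (suc i) ⟩
    0ℚ ∎

-- At half-integers none of the denominators t + a with a ∈ ℤ vanishes.
node : ℕ → ℚ
node s = ι (+ s) +ℚ ℚ.½

ι-injective : ∀ {z w} → ι z ≡ ι w → z ≡ w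
ι-injective {z} {w} eq with *≡* z*1≡w*1 ← ℚ./-injective-≃ (mkℚᵘ z 0) (mkℚᵘ w 0) eq =
  trans (sym (ℤ.*-identityʳ z)) (trans z*1≡w*1 (ℤ.*-identityʳ w))

node-injective : ∀ {i j} → node i ≡ node j → i ≡ j
node-injective {i} {j} eq =
  ℤ.+-injective (ι-injective (∙-cancelʳ ℚ.+-0-group ℚ.½ (ι (+ i)) (ι (+ j)) eq))

odd≢0 : ∀ z → z ℤ.+ (+ 1 ℤ.+ z) ≢ + 0
odd≢0 (+ zero)           ()
odd≢0 (+ suc n)          ()
odd≢0 ℤ.-[1+ zero ]      ()
odd≢0 ℤ.-[1+ suc n ]     ()

-- Doubling the sum gives the odd integer z + (1 + z) with z = s + y; `ℚ.½ +ℚ ℚ.½` computes to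
-- `ι (+ 1)`.
node+ι≢0 : ∀ s y → node s +ℚ ι y ≢ 0ℚ
node+ι≢0 s y eq = odd≢0 z (ι-injective (begin
  ι (z ℤ.+ (+ 1 ℤ.+ z))                          ≡⟨ trans (ι-+ z (+ 1 ℤ.+ z)) (cong (ι z +ℚ_) (ι-+ (+ 1) z)) ⟩
  ι z +ℚ (ℚ.½ +ℚ ℚ.½ +ℚ ι z)                     ≡⟨ cong (λ e → e +ℚ (ℚ.½ +ℚ ℚ.½ +ℚ e)) (ι-+ (+ s) y) ⟩
  ι (+ s) +ℚ ι y +ℚ (ℚ.½ +ℚ ℚ.½ +ℚ (ι (+ s) +ℚ ι y))  ≡⟨ rearrange (ι (+ s)) (ι y) ℚ.½ ⟩
  (node s +ℚ ι y) +ℚ (node s +ℚ ι y)             ≡⟨ cong₂ _+ℚ_ eq eq ⟩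
  0ℚ                                             ∎))
  where
  z = + s ℤ.+ y

  rearrange : ∀ a b h → a +ℚ b +ℚ (h +ℚ h +ℚ (a +ℚ b)) ≡ (a +ℚ h +ℚ b) +ℚ (a +ℚ h +ℚ b)
  rearrange = solve-∀ ℚ-ring

inverse : ℕ → ℤ → ℚ
inverse s y = (ℚ.1/ (node s +ℚ ι y)) {{ℚ.≢-nonZero (node+ι≢0 s y)}}

inverse-inverse : ∀ s y → (node s +ℚ ι y) *ℚ inverse s y ≡ 1ℚ
inverse-inverse s y = ℚ.*-inverseʳ (node s +ℚ ι y) {{ℚ.≢-nonZero (node+ι≢0 s y)}}

eval-≡⇒≈ₚ : ∀ p q → (∀ s → eval p (node s) ≡ eval q (node s)) → p ≈ₚ q
eval-≡⇒≈ₚ p q p≡q n = begin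
  coeff p n                                              ≡⟨ restore (coeff p n) (coeff q n) ⟩
  (coeff p n +ℚ (ℚ.- 1ℚ) *ℚ coeff q n) +ℚ coeff q n      ≡⟨ cong (λ e → coeff p n +ℚ e +ℚ coeff q n) (coeff-· (ℚ.- 1ℚ) q n) ⟨
  (coeff p n +ℚ coeff ((ℚ.- 1ℚ) ·ₚ q) n) +ℚ coeff q n    ≡⟨ cong (_+ℚ coeff q n) (coeff-+ p _ n) ⟨
  coeff r n +ℚ coeff q n                                 ≡⟨ cong (_+ℚ coeff q n) (vanishing⇒≈0 _ r refl node node-injective vanish n) ⟩
  0ℚ +ℚ coeff q n                                        ≡⟨ ℚ.+-identityˡ (coeff q n) ⟩
  coeff q n                                              ∎
  where
  r = p +ₚ (ℚ.- 1ℚ) ·ₚ q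

  restore : ∀ a b → a ≡ (a +ℚ (ℚ.- 1ℚ) *ℚ b) +ℚ b
  restore = solve-∀ ℚ-ring

  cancel : ∀ a → a +ℚ (ℚ.- 1ℚ) *ℚ a ≡ 0ℚ
  cancel = solve-∀ ℚ-ring

  vanish : ∀ s → eval r (node s) ≡ 0ℚ
  vanish s = begin
    eval r (node s)                                          ≡⟨ eval-+ₚ p ((ℚ.- 1ℚ) ·ₚ q) (node s) ⟩
    eval p (node s) +ℚ eval ((ℚ.- 1ℚ) ·ₚ q) (node s)         ≡⟨ cong₂ _+ℚ_ (p≡q s) (eval-·ₚ (ℚ.- 1ℚ) q (node s)) ⟩
    eval q (node s) +ℚ (ℚ.- 1ℚ) *ℚ eval q (node s)           ≡⟨ cancel (eval q (node s)) ⟩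
    0ℚ                                                       ∎

infix 4 _[_]↦_

-- The fraction takes the value r at t. With multiplication instead of division, values of sums and
-- products follow from ring identities, and a common value of two fractions gives their
-- cross-multiplied equation at t.
_[_]↦_ : RatFun → ℚ → ℚ → Set
f [ t ]↦ r = eval (num f) t ≡ r *ℚ eval (den f) t

↦⇒≈ : ∀ f g → (∀ s → ∃ λ r → f [ node s ]↦ r × g [ node s ]↦ r) → f ≈ g
↦⇒≈ f g values = eval-≡⇒≈ₚ (num f *ₚ den g) (num g *ₚ den f) equal
  where
  swap : ∀ r a b → r *ℚ a *ℚ b ≡ r *ℚ b *ℚ a
  swap = solve-∀ ℚ-ring

  equal : ∀ s → eval (num f *ₚ den g) (node s) ≡ eval (num g *ₚ den f) (node s)
  equal s with values s
  ... | r , f↦ , g↦ = begin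
    eval (num f *ₚ den g) (node s)                            ≡⟨ eval-*ₚ (num f) (den g) (node s) ⟩
    eval (num f) (node s) *ℚ eval (den g) (node s)            ≡⟨ cong (_*ℚ eval (den g) (node s)) f↦ ⟩
    r *ℚ eval (den f) (node s) *ℚ eval (den g) (node s)       ≡⟨ swap r (eval (den f) (node s)) (eval (den g) (node s)) ⟩
    r *ℚ eval (den g) (node s) *ℚ eval (den f) (node s)       ≡⟨ cong (_*ℚ eval (den f) (node s)) g↦ ⟨
    eval (num g) (node s) *ℚ eval (den f) (node s)            ≡⟨ eval-*ₚ (num g) (den f) (node s) ⟨
    eval (num g *ₚ den f) (node s)                            ∎

module _ (t : ℚ) where

  ↦-const : ∀ a → const a [ t ]↦ a
  ↦-const a = simplify a t
    where
    simplify : ∀ a t → a +ℚ t *ℚ 0ℚ ≡ a *ℚ (1ℚ +ℚ t *ℚ 0ℚ)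
    simplify = solve-∀ ℚ-ring

  ↦-+ : ∀ f g {r s} → f [ t ]↦ r → g [ t ]↦ s → f + g [ t ]↦ r +ℚ s
  ↦-+ f g {r} {s} f↦ g↦ = begin
    eval (num f *ₚ den g +ₚ num g *ₚ den f) t
      ≡⟨ trans (eval-+ₚ (num f *ₚ den g) (num g *ₚ den f) t)
           (cong₂ _+ℚ_ (eval-*ₚ (num f) (den g) t) (eval-*ₚ (num g) (den f) t)) ⟩
    eval (num f) t *ℚ eval (den g) t +ℚ eval (num g) t *ℚ eval (den f) t
      ≡⟨ cong₂ (λ a b → a *ℚ eval (den g) t +ℚ b *ℚ eval (den f) t) f↦ g↦ ⟩
    r *ℚ eval (den f) t *ℚ eval (den g) t +ℚ s *ℚ eval (den g) t *ℚ eval (den f) t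
      ≡⟨ factor r s (eval (den f) t) (eval (den g) t) ⟩
    (r +ℚ s) *ℚ (eval (den f) t *ℚ eval (den g) t)
      ≡⟨ cong ((r +ℚ s) *ℚ_) (eval-*ₚ (den f) (den g) t) ⟨
    (r +ℚ s) *ℚ eval (den f *ₚ den g) t ∎
    where
    factor : ∀ r s a b → r *ℚ a *ℚ b +ℚ s *ℚ b *ℚ a ≡ (r +ℚ s) *ℚ (a *ℚ b)
    factor = solve-∀ ℚ-ring

  ↦-* : ∀ f g {r s} → f [ t ]↦ r → g [ t ]↦ s → f * g [ t ]↦ r *ℚ s
  ↦-* f g {r} {s} f↦ g↦ = begin
    eval (num f *ₚ num g) t
      ≡⟨ trans (eval-*ₚ (num f) (num g) t) (cong₂ _*ℚ_ f↦ g↦) ⟩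
    r *ℚ eval (den f) t *ℚ (s *ℚ eval (den g) t)
      ≡⟨ *-interchange r (eval (den f) t) s (eval (den g) t) ⟩
    r *ℚ s *ℚ (eval (den f) t *ℚ eval (den g) t)
      ≡⟨ cong (r *ℚ s *ℚ_) (eval-*ₚ (den f) (den g) t) ⟨
    r *ℚ s *ℚ eval (den f *ₚ den g) t ∎

  ↦-∏ : ∀ {n} (f : Fin n → RatFun) {r : Fin n → ℚ} → (∀ i → f i [ t ]↦ r i) → ∏ f [ t ]↦ ∏ℚ r
  ↦-∏ {zero}  f f↦ = ↦-const 1ℚ
  ↦-∏ {suc n} f {r} f↦ = ↦-* (f zero) (∏ (f ∘ suc)) {r zero} {∏ℚ (r ∘ suc)} (f↦ zero) (↦-∏ (f ∘ suc) {r ∘ suc} (f↦ ∘ suc))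

  ↦-∑ : ∀ ks (f : ℤ → RatFun) {r : ℤ → ℚ} → (∀ k → f k [ t ]↦ r k) → ∑ ks f [ t ]↦ sum r ks
  ↦-∑ []       f f↦ = ↦-const 0ℚ
  ↦-∑ (k ∷ ks) f {r} f↦ = ↦-+ (f k) (∑ ks f) {r k} {sum r ks} (f↦ k) (↦-∑ ks f {r} f↦)

-- Values of both sides at a half-integer

module _ (s : ℕ) where
  private
    t = node s
    φ = inverse s

    shift-factor : ∀ a b → eval (t+ a) t ≡ (t +ℚ ι a) *ℚ φ b *ℚ eval (t+ b) t
    shift-factor a b = begin
      eval (t+ a) t                                   ≡⟨ eval-t+ a t ⟩
      t +ℚ ι a                                        ≡⟨ ℚ.*-identityʳ (t +ℚ ι a) ⟨
      (t +ℚ ι a) *ℚ 1ℚ                                ≡⟨ cong ((t +ℚ ι a) *ℚ_) (inverse-inverse s b) ⟨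
      (t +ℚ ι a) *ℚ ((t +ℚ ι b) *ℚ φ b)               ≡⟨ swap (t +ℚ ι a) (t +ℚ ι b) (φ b) ⟩
      (t +ℚ ι a) *ℚ φ b *ℚ (t +ℚ ι b)                 ≡⟨ cong ((t +ℚ ι a) *ℚ φ b *ℚ_) (eval-t+ b t) ⟨
      (t +ℚ ι a) *ℚ φ b *ℚ eval (t+ b) t              ∎
      where
      swap : ∀ a b c → a *ℚ (b *ℚ c) ≡ a *ℚ c *ℚ b
      swap = solve-∀ ℚ-ring

  ↦-H* : ∀ {n} (ν : Sig n) →
         H* ν [ t ]↦ ∏ℚ (λ (j : Fin n) → t +ℚ ι (pos j)) *ℚ ∏ℚ (λ j → φ (pos j ℤ.- ν ! j))
  ↦-H* {n} ν = subst (λ r → H* ν [ t ]↦ r) (∏ℚ-* (λ j → t +ℚ ι (pos j)) (λ j → φ (pos j ℤ.- ν ! j)))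
    (↦-∏ t _ {λ j → (t +ℚ ι (pos j)) *ℚ φ (pos j ℤ.- ν ! j)} (λ j → shift-factor (pos j) (pos j ℤ.- ν ! j)))

  ↦-kernel : ∀ n k →
    kernel n k [ t ]↦ ∏ℚ (λ (j : Fin n) → t +ℚ ι (pos j)) *ℚ ∏ℚ (λ (j : Fin n) → φ (pos j ℤ.- k))
  ↦-kernel n k = begin
    eval (∏ₚ {n} (λ j → t+ pos j)) t
      ≡⟨ eval-∏ₚ {n} (λ j → t+ pos j) t ⟩
    ∏ℚ {n} (λ j → eval (t+ pos j) t)
      ≡⟨ ∏ℚ-cong {n} (λ j → shift-factor (pos j) (pos j ℤ.- k)) ⟩
    ∏ℚ {n} (λ j → (t +ℚ ι (pos j)) *ℚ φ (pos j ℤ.- k) *ℚ eval (t+ (pos j ℤ.- k)) t)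
      ≡⟨ trans (∏ℚ-* {n} (λ j → (t +ℚ ι (pos j)) *ℚ φ (pos j ℤ.- k)) (λ j → eval (t+ (pos j ℤ.- k)) t))
           (cong₂ _*ℚ_ (∏ℚ-* {n} (λ j → t +ℚ ι (pos j)) (λ j → φ (pos j ℤ.- k)))
             (sym (eval-∏ₚ {n} (λ j → t+ (pos j ℤ.- k)) t))) ⟩
    ∏ℚ {n} (λ j → t +ℚ ι (pos j)) *ℚ ∏ℚ {n} (λ j → φ (pos j ℤ.- k)) *ℚ eval (shifted n k) t ∎

F-outside : ∀ {n} k (ν : Sig (suc n)) → ¬ (ν ! fromℕ n ≤ k × k ≤ ν ! zero) → F k ν ≡ 0ℚ
F-outside k ν out = trans (cong (_*ℚ (ℚ.1/ Dim ν) {{Dim-nonZero ν}}) (count-outside k ν out))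
                          (ℚ.*-zeroˡ ((ℚ.1/ Dim ν) {{Dim-nonZero ν}}))

theorem3 : ∀ (n : ℕ) (ν : Sig (suc n)) →
    (∀ (k : ℤ) → ¬ (ν ! fromℕ n ≤ k × k ≤ ν ! zero) → F k ν ≡ 0ℚ) ×
    IsSumOverℤ (λ k → const (F k ν) * kernel (suc n) k) (H* ν)
theorem3 n ν = (λ k → F-outside k ν) , record
  { support   = ks
  ; unique    = interval-unique (ν ! fromℕ n) (ν ! zero)
  ; vanishing = λ k k∉ → ↦⇒≈ (term k) 0# λ s → 0ℚ ,
      subst (λ r → term k [ node s ]↦ r)
        (trans (cong (_*ℚ value s k) (F-outside k ν λ (lo , hi) → k∉ (interval⁺ lo hi))) (ℚ.*-zeroˡ (value s k)))
        (↦-term s k) ,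
      ↦-const (node s) 0ℚ
  ; total     = ↦⇒≈ (H* ν) (∑ ks term) λ s → sum (λ k → F k ν *ℚ value s k) ks ,
      subst (λ r → H* ν [ node s ]↦ r) (sym (sum-value s)) (↦-H* s ν) ,
      ↦-∑ (node s) ks term {λ k → F k ν *ℚ value s k} (↦-term s)
  }
  where
  ks = interval (ν ! fromℕ n) (ν ! zero)
  term = λ k → const (F k ν) * kernel (suc n) k

  numerator : ℕ → ℚ
  numerator s = ∏ℚ {suc n} (λ j → node s +ℚ ι (pos j))

  value : ℕ → ℤ → ℚ
  value s k = numerator s *ℚ ∏ℚ {suc n} (λ j → inverse s (pos j ℤ.- k))

  ↦-term : ∀ s k → term k [ node s ]↦ F k ν *ℚ value s k
  ↦-term s k = ↦-* (node s) (const (F k ν)) (kernel (suc n) k) {F k ν} {value s k} (↦-const (node s) (F k ν)) (↦-kernel s (suc n) k)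

  -- The factor (t + 1)⋯(t + N) is common to `H* ν` and all kernels; once it is pulled out,
  -- `Cauchy.sum-F` remains.
  sum-value : ∀ s → sum (λ k → F k ν *ℚ value s k) ks ≡
                    numerator s *ℚ ∏ℚ (λ j → inverse s (pos j ℤ.- ν ! j))
  sum-value s = begin
    sum (λ k → F k ν *ℚ value s k) ks
      ≡⟨ sum-cong (λ k → swap (F k ν) (numerator s) (∏ℚ {suc n} (λ j → inverse s (pos j ℤ.- k)))) ks ⟩
    sum (λ k → numerator s *ℚ (F k ν *ℚ ∏ℚ {suc n} (λ j → inverse s (pos j ℤ.- k)))) ks
      ≡⟨ sum-*ˡ (numerator s) (λ k → F k ν *ℚ ∏ℚ {suc n} (λ j → inverse s (pos j ℤ.- k))) ks ⟩
    numerator s *ℚ sum (λ k → F k ν *ℚ ∏ℚ {suc n} (λ j → inverse s (pos j ℤ.- k))) ks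
      ≡⟨ cong (numerator s *ℚ_) (Cauchy.sum-F (node s) (inverse s) (inverse-inverse s) ν) ⟩
    numerator s *ℚ ∏ℚ (λ j → inverse s (pos j ℤ.- ν ! j)) ∎
    where
    swap : ∀ a b c → a *ℚ (b *ℚ c) ≡ b *ℚ (a *ℚ c)
    swap = solve-∀ ℚ-ring
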